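{- Let $q, \ell, t$ be positive integers. The number of $t$-tail-heavy words of length $\ell$ and depth $q$ is at most $t\, q^{t}\, c_q^{\ell + \sqrt{\ell} + 10}$.
   Context: A word $w_1 \cdots w_\ell \in \{1,\dots,q\}^\ell$ is $t$-tail-heavy of depth $q$ if there exist $n > \sqrt{\ell}$ indices $i_1, \dots, i_n$, all greater than $\ell - t$, such that $w_{i_1} = \cdots = w_{i_n} = q$, and such that for all (not necessarily distinct) $x, y \leq \ell - t$ with $x + y \in \{i_1, \dots, i_n\}$ we have $w_x + w_y \geq q$. For $q \geq 1$, $c_q := \sqrt{\lfloor (q+2)^2/4 \rfloor}$. -}

module Defs where

open import Algebra.Definitions.RawSemiring using () renaming (_^_ to pow)
open import Data.Fin using (Fin; toℕ)
open import Data.Fin.Properties using (all?)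
open import Data.Fin.Subset using (Subset; _∈_; ∣_∣)
open import Data.Fin.Subset.Properties using (_∈?_; anySubset?)
open import Data.Integer using (+_) renaming (∣_∣ to absℤ)
open import Data.List using (List; []; _∷_; length; filter; cartesianProductWith; allFin)
open import Data.List.Membership.Propositional using () renaming (_∈_ to _∈ˡ_)
open import Data.List.Membership.Propositional.Properties using (∈-cartesianProductWith⁺; ∈-allFin)
open import Data.List.Relation.Unary.All using ([])
open import Data.List.Relation.Unary.Any using (here)
open import Data.List.Relation.Unary.Unique.Propositional using (Unique; []; _∷_)
open import Data.List.Relation.Unary.Unique.Propositional.Properties using (cartesianProductWith⁺; allFin⁺)
open import Data.Nat using (ℕ; zero; suc; _+_; _*_; _≤_; _<_; _/_; _≟_; _≤?_; _<?_)
open import Data.Product using (Σ; ∃; _×_; _,_)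
open import Data.Rational using (ℚ; 0ℚ; 1ℚ; ↥_; ↧ₙ_; +-*-rawSemiring; nonNegative)
import Data.Rational as ℚ
import Data.Rational.Properties as ℚₚ
open import Data.Vec using (Vec; []; _∷_; lookup)
open import Data.Vec.Properties using (∷-injective)
open import Relation.Binary.PropositionalEquality using (_≡_; refl; sym; subst)
open import Relation.Nullary using (Dec)
open import Relation.Nullary.Decidable using (_×-dec_; _→-dec_)

-- The element j : Fin q stands for the letter toℕ j + 1 ∈ {1,…,q}.
Word : ℕ → ℕ → Set
Word q ℓ = Vec (Fin q) ℓ

position : ∀ {ℓ} → Fin ℓ → ℕ
position i = suc (toℕ i)

letter : ∀ {q ℓ} → Word q ℓ → Fin ℓ → ℕ
letter w i = suc (toℕ (lookup w i))

-- S is the set {i₁,…,iₙ} of n = ∣ S ∣ distinct indices.  The condition n > √ℓ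
-- is written ℓ < n², and i > ℓ - t, x ≤ ℓ - t are written without subtraction
-- because t may exceed ℓ.
Witness : ∀ {q ℓ} → ℕ → Word q ℓ → Subset ℓ → Set
Witness {q} {ℓ} t w S =
    ℓ < ∣ S ∣ * ∣ S ∣
  × (∀ i → i ∈ S → ℓ < position i + t × letter w i ≡ q)
  × (∀ x y i → position x + t ≤ ℓ → position y + t ≤ ℓ →
       i ∈ S → position x + position y ≡ position i →
       q ≤ letter w x + letter w y)

TailHeavy : ∀ {q ℓ} → ℕ → Word q ℓ → Set
TailHeavy {q} {ℓ} t w = Σ (Subset ℓ) (Witness t w)

witness? : ∀ {q ℓ} t (w : Word q ℓ) (S : Subset ℓ) → Dec (Witness t w S)
witness? {q} {ℓ} t w S =
        (ℓ <? ∣ S ∣ * ∣ S ∣)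
  ×-dec all? (λ i → (i ∈? S) →-dec ((ℓ <? position i + t) ×-dec (letter w i ≟ q)))
  ×-dec all? (λ x → all? (λ y → all? (λ i →
          (position x + t ≤? ℓ) →-dec ((position y + t ≤? ℓ) →-dec
          ((i ∈? S) →-dec ((position x + position y ≟ position i) →-dec
          (q ≤? letter w x + letter w y)))))))

tailHeavy? : ∀ {q ℓ} t (w : Word q ℓ) → Dec (TailHeavy t w)
tailHeavy? t w = anySubset? (witness? t w)

words : ∀ q ℓ → List (Word q ℓ)
words q zero    = [] ∷ []
words q (suc ℓ) = cartesianProductWith _∷_ (allFin q) (words q ℓ)

words-complete : ∀ {q ℓ} (w : Word q ℓ) → w ∈ˡ words q ℓ
words-complete []      = here refl
words-complete (a ∷ w) = ∈-cartesianProductWith⁺ _∷_ (∈-allFin a) (words-complete w)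

words-unique : ∀ q ℓ → Unique (words q ℓ)
words-unique q zero    = [] ∷ []
words-unique q (suc ℓ) = cartesianProductWith⁺ _∷_ ∷-injective (allFin⁺ q) (words-unique q ℓ)

numTailHeavy : ℕ → ℕ → ℕ → ℕ
numTailHeavy q ℓ t = length (filter (tailHeavy? t) (words q ℓ))

infixr 8 _^ℚ_
_^ℚ_ : ℚ → ℕ → ℚ
_^ℚ_ = pow +-*-rawSemiring

ℕ→ℚ : ℕ → ℚ
ℕ→ℚ n = + n ℚ./ 1

private
  0≤ℕ : ∀ n → 0ℚ ℚ.≤ ℕ→ℚ n
  0≤ℕ n = ℚₚ.nonNegative⁻¹ (ℕ→ℚ n) {{ℚₚ.normalize-nonNeg n 1}}

  0≤1 : 0ℚ ℚ.≤ 1ℚ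
  0≤1 = ℚₚ.nonNegative⁻¹ 1ℚ

  0≤+ : ∀ {a b} → 0ℚ ℚ.≤ a → 0ℚ ℚ.≤ b → 0ℚ ℚ.≤ a ℚ.+ b
  0≤+ = ℚₚ.+-mono-≤

  0≤* : ∀ {a b} → 0ℚ ℚ.≤ a → 0ℚ ℚ.≤ b → 0ℚ ℚ.≤ a ℚ.* b
  0≤* {a} {b} 0≤a 0≤b =
    subst (ℚ._≤ a ℚ.* b) (ℚₚ.*-zeroʳ a) (ℚₚ.*-monoˡ-≤-nonNeg a {{nonNegative 0≤a}} 0≤b)

  0≤^ : ∀ {s} n → 0ℚ ℚ.≤ s → 0ℚ ℚ.≤ s ^ℚ n
  0≤^ zero    0≤s = 0≤1
  0≤^ (suc n) 0≤s = 0≤* 0≤s (0≤^ n 0≤s)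

  a≤a*b : ∀ {a b} → 0ℚ ℚ.≤ a → 1ℚ ℚ.≤ b → a ℚ.≤ a ℚ.* b
  a≤a*b {a} {b} 0≤a 1≤b =
    subst (ℚ._≤ a ℚ.* b) (ℚₚ.*-identityʳ a) (ℚₚ.*-monoˡ-≤-nonNeg a {{nonNegative 0≤a}} 1≤b)

  1≤^ : ∀ {u} n → 1ℚ ℚ.≤ u → 1ℚ ℚ.≤ u ^ℚ n
  1≤^ zero    1≤u = ℚₚ.≤-refl
  1≤^ (suc n) 1≤u = ℚₚ.≤-trans 1≤u (a≤a*b (ℚₚ.≤-trans 0≤1 1≤u) (1≤^ n 1≤u))

  1≤1+ : ∀ {a} → 0ℚ ℚ.≤ a → 1ℚ ℚ.≤ 1ℚ ℚ.+ a
  1≤1+ 0≤a = ℚₚ.+-monoʳ-≤ 1ℚ 0≤a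

  a≤1+a : ∀ a → a ℚ.≤ 1ℚ ℚ.+ a
  a≤1+a a = subst (ℚ._≤ 1ℚ ℚ.+ a) (ℚₚ.+-identityˡ a) (ℚₚ.+-monoˡ-≤ a 0≤1)

  a≤[1+a]^ : ∀ {a} n → 0ℚ ℚ.≤ a → a ℚ.≤ (1ℚ ℚ.+ a) ^ℚ suc n
  a≤[1+a]^ {a} n 0≤a =
    ℚₚ.≤-trans (a≤1+a a) (a≤a*b (0≤+ 0≤1 0≤a) (1≤^ n (1≤1+ 0≤a)))

-- A nonnegative real, presented as the infimum of an inhabited set of
-- nonnegative rationals.
record ℝ⁺ : Set₁ where
  field
    Upper     : ℚ → Set
    inhabited : ∃ Upper
    nonneg    : ∀ {u} → Upper u → 0ℚ ℚ.≤ u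

open ℝ⁺ public

-- inf X ≤ inf Y: every rational above some element of Y is above some element of X.
infix 4 _≤ᴿ_
_≤ᴿ_ : ℝ⁺ → ℝ⁺ → Set
x ≤ᴿ y = ∀ {v r} → Upper y v → v ℚ.< r → ∃ λ u → Upper x u × u ℚ.< r

ℕ→ℝ : ℕ → ℝ⁺
ℕ→ℝ n = record
  { Upper     = λ u → ℕ→ℚ n ℚ.≤ u
  ; inhabited = ℕ→ℚ n , ℚₚ.≤-refl
  ; nonneg    = ℚₚ.≤-trans (0≤ℕ n)
  }

√ : ℕ → ℝ⁺
√ n = record
  { Upper     = λ u → 0ℚ ℚ.≤ u × ℕ→ℚ n ℚ.≤ u ^ℚ 2
  ; inhabited = 1ℚ ℚ.+ ℕ→ℚ n , 0≤+ 0≤1 (0≤ℕ n) , a≤[1+a]^ 1 (0≤ℕ n)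
  ; nonneg    = λ (0≤u , _) → 0≤u
  }

infixl 6 _+ᴿ_
_+ᴿ_ : ℝ⁺ → ℝ⁺ → ℝ⁺
x +ᴿ y = record
  { Upper     = λ u → ∃ λ a → ∃ λ b → Upper x a × Upper y b × u ≡ a ℚ.+ b
  ; inhabited = let (a , xa) = inhabited x ; (b , yb) = inhabited y
                in a ℚ.+ b , a , b , xa , yb , refl
  ; nonneg    = λ (a , b , xa , yb , u≡) →
                  subst (0ℚ ℚ.≤_) (sym u≡) (0≤+ (nonneg x xa) (nonneg y yb))
  }

infixl 7 _*ᴿ_
_*ᴿ_ : ℝ⁺ → ℝ⁺ → ℝ⁺
x *ᴿ y = record
  { Upper     = λ u → ∃ λ a → ∃ λ b → Upper x a × Upper y b × u ≡ a ℚ.* b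
  ; inhabited = let (a , xa) = inhabited x ; (b , yb) = inhabited y
                in a ℚ.* b , a , b , xa , yb , refl
  ; nonneg    = λ (a , b , xa , yb , u≡) →
                  subst (0ℚ ℚ.≤_) (sym u≡) (0≤* (nonneg x xa) (nonneg y yb))
  }

-- The numerator of an exponent p ∈ Upper y, which is nonnegative.
num : ℚ → ℕ
num p = absℤ (↥ p)

-- Real power for a base x ≥ 1: x^y is the infimum of s^p over rationals s ∈ Upper x,
-- p ∈ Upper y, where s^p ≤ u means s^(num p) ≤ u^(den p).  (For x < 1 the power
-- decreases in the exponent and this is not the right formula.)
infixr 8 _^ᴿ_
_^ᴿ_ : ℝ⁺ → ℝ⁺ → ℝ⁺
x ^ᴿ y = record
  { Upper     = λ u → 0ℚ ℚ.≤ u × ∃ λ s → ∃ λ p →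
                  Upper x s × Upper y p × s ^ℚ num p ℚ.≤ u ^ℚ (↧ₙ p)
  ; inhabited = let (s , xs) = inhabited x
                    (p , yp) = inhabited y
                    0≤sᵖ = 0≤^ (num p) (nonneg x xs)
                in 1ℚ ℚ.+ s ^ℚ num p , 0≤+ 0≤1 0≤sᵖ ,
                   s , p , xs , yp , a≤[1+a]^ (ℚ.denominator-1 p) 0≤sᵖ
  ; nonneg    = λ (0≤u , _) → 0≤u
  }

-- For q ≥ 1 the radicand is at least 2, so c q is a legitimate base for _^ᴿ_.
c : ℕ → ℝ⁺
c q = √ ((q + 2) * (q + 2) / 4)

{-# OPTIONS --safe #-}

-- Write C = c_q².  If ℓ < 3t the bound q^ℓ on all words suffices.  Otherwise keep only the
-- constraints w_x + w_y ≥ q, x + y = i ∈ S, between a block B and a block A such that every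
-- letter of B has n = |S| neighbours in A and every letter of A has at most n in B.  Given the
-- letters of A, a letter of B whose neighbours have minimum M has at most M + 1 choices, so the
-- number of fillings of A and B is a sum over A of a product of functions, each depending on n
-- letters only.  Hölder's inequality in Finner's form bounds its n-th power by a product of
-- one-vertex sums ∑_M (q + 1 − M)^n (M + 1)^n ≤ q C^n, that is, the count by
-- q^t C^|B| q^(|B|/n), and |B|/n ≤ √ℓ/2.  Summing over the tails and over S costs (q + 1)^t,
-- which is absorbed by q² (q + 1)² ≤ C³.
module Submission where

open import Defs
open import Algebra.Bundles using (CommutativeRing)
open import Data.Bool using (Bool; true; false; _∧_; _∨_; not; T)
open import Data.Bool.Properties using (T-∧)
open import Data.Empty using (⊥; ⊥-elim)
open import Data.Fin using (Fin; zero; suc; toℕ; _↑ˡ_; _↑ʳ_)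
open import Data.Fin.Properties using (toℕ<n; toℕ-injective; toℕ-↑ˡ; toℕ-↑ʳ)
open import Data.Fin.Subset using (Subset; _∈_; _∉_; ∣_∣)
import Data.Integer as ℤ
import Data.Integer.Properties as ℤₚ
open import Data.List using (List; []; _∷_; length; map; replicate; cartesianProductWith; allFin; filter) renaming (_++_ to _++ˡ_)
open import Data.List.Membership.Propositional using () renaming (_∈_ to _∈ˡ_)
open import Data.List.Membership.Propositional.Properties using (∈-allFin; ∈-cartesianProductWith⁺)
open import Data.List.Properties using (length-++; length-map; length-replicate; length-tabulate; map-++; map-cong; map-tabulate)
open import Data.List.Relation.Unary.All as All using (All; []; _∷_)
open import Data.List.Relation.Unary.Any using (here; there)
open import Data.Nat
open import Data.Nat.DivMod using (m*n/n≡m; /-monoˡ-≤; m≡m%n+[m/n]*n; m%n<n)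
open import Data.Nat.ListAction using (sum; product)
open import Data.Nat.ListAction.Properties using (sum-++; product-++)
open import Data.Nat.Properties
open import Data.Nat.Tactic.RingSolver using (solve-∀)
open import Data.Product using (∃; _×_; _,_; proj₁; proj₂)
open import Data.Rational as ℚ using (ℚ; 0ℚ; ↧ₙ_; mkℚ)
import Data.Rational.Properties as ℚₚ
open import Data.Rational.Unnormalised using (mkℚᵘ; *≡*; *≤*)
import Data.Rational.Unnormalised as ℚᵘ
import Data.Rational.Unnormalised.Properties as ℚᵘₚ
open import Data.Sum using (_⊎_; inj₁; inj₂)
open import Data.Unit using (tt)
open import Data.Vec using (Vec; []; _∷_; _++_; lookup; here; there)
open import Data.Vec.Properties using (lookup-++ˡ; lookup-++ʳ)
open import Function using (_∘_; _$_; const; id; it; Equivalence)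
open import Relation.Binary.PropositionalEquality
open import Relation.Nullary using (does; yes; no; contradiction)
open import Relation.Unary using (Decidable)
open import Algebra.Properties.CommutativeSemiring.Exp (CommutativeRing.commutativeSemiring ℚₚ.+-*-commutativeRing) using () renaming (^-distrib-* to ^ℚ-distrib-*; ^-assocʳ to ^ℚ-assocʳ)

-- A letter of A is a neighbour of several letters of B, so the choices for different letters of B
-- are not independent. That it enters at most n of the functions is exactly what makes the exponent
-- 1/n admissible in Finner's inequality. The constant comes from a balance at one letter of B: if
-- all its neighbours are at least M, each of them has q + 1 - M options and the letter itself at
-- most M + 1. The two numbers sum to q + 2, so their product is at most floor((q + 2)² / 4) = C,
-- and each letter of such a pair costs c_q on average. All counting takes place in ℕ, without roots
-- or quotients. Averages are therefore multiplied out by powers of q, rational constants become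
-- pairs of factors, and bounds are stated for n-th powers. Since n = |S| varies with S, bounds of
-- this kind for different S cannot be added; one S that maximises the number of fillings takes the
-- place of all the others before any root is estimated.

private
  variable
    A B I X Y : Set

∑ ∏ : List A → (A → ℕ) → ℕ
∑ xs f = sum (map f xs)
∏ xs f = product (map f xs)

bit : Bool → ℕ
bit true  = 1
bit false = 0

-- The inequality of arithmetic and geometric means.

^-distrib-* : ∀ a b n → (a * b) ^ n ≡ a ^ n * b ^ n
^-distrib-* a b zero    = refl
^-distrib-* a b (suc n) = trans (cong (a * b *_) (^-distrib-* a b n)) (lemma a b (a ^ n) (b ^ n))
  where
  lemma : ∀ a b u v → a * b * (u * v) ≡ a * u * (b * v)
  lemma = solve-∀

2uv≤u²+v² : ∀ u v → 2 * (u * v) ≤ u * u + v * v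
2uv≤u²+v² u v with ≤-total u v
... | inj₁ u≤v = subst (λ w → 2 * (u * w) ≤ u * u + w * w) (m+[n∸m]≡n u≤v) (lemma u (v ∸ u))
  where
  lemma : ∀ u d → 2 * (u * (u + d)) ≤ u * u + (u + d) * (u + d)
  lemma u d = ≤-trans (m≤m+n _ (d * d)) (≤-reflexive (identity u d))
    where
    identity : ∀ u d → 2 * (u * (u + d)) + d * d ≡ u * u + (u + d) * (u + d)
    identity = solve-∀
... | inj₂ v≤u = subst (λ w → 2 * (w * v) ≤ w * w + v * v) (m+[n∸m]≡n v≤u) (lemma v (u ∸ v))
  where
  lemma : ∀ v d → 2 * ((v + d) * v) ≤ (v + d) * (v + d) + v * v
  lemma v d = ≤-trans (m≤m+n _ (d * d)) (≤-reflexive (identity v d))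
    where
    identity : ∀ v d → 2 * ((v + d) * v) + d * d ≡ (v + d) * (v + d) + v * v
    identity = solve-∀

-- The term cancelled in the step turns the left side into (n + 1) · 2uv · v^n, to which 2uv ≤ u² +
-- v² applies; what results contains the induction hypothesis multiplied by u.
young : ∀ n u v → suc n * (u * v ^ n) ≤ u ^ suc n + n * v ^ suc n
young zero    u v = ≤-reflexive (lemma u)
  where
  lemma : ∀ u → 1 * (u * 1) ≡ u * 1 + 0
  lemma = solve-∀
young (suc n) u v = +-cancelʳ-≤ (n * (u * (v * V))) _ _ (begin
  (2 + n) * (u * (v * V)) + n * (u * (v * V))              ≡⟨ expand n u v V ⟩
  suc n * (2 * (u * v) * V)                                ≤⟨ *-monoʳ-≤ (suc n) (*-monoˡ-≤ V (2uv≤u²+v² u v)) ⟩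
  suc n * ((u * u + v * v) * V)                            ≡⟨ regroup n u v V ⟩
  u * (suc n * (u * V)) + suc n * (v * (v * V))            ≤⟨ +-monoˡ-≤ _ (*-monoʳ-≤ u (young n u v)) ⟩
  u * (U + n * (v * V)) + suc n * (v * (v * V))            ≡⟨ collect n u v U V ⟩
  u * U + suc n * (v * (v * V)) + n * (u * (v * V))        ∎)
  where
  open ≤-Reasoning
  U = u ^ suc n
  V = v ^ n
  expand : ∀ n u v V → (2 + n) * (u * (v * V)) + n * (u * (v * V)) ≡ suc n * (2 * (u * v) * V)
  expand = solve-∀
  regroup : ∀ n u v V → suc n * ((u * u + v * v) * V) ≡ u * (suc n * (u * V)) + suc n * (v * (v * V))
  regroup = solve-∀
  collect : ∀ n u v U V → u * (U + n * (v * V)) + suc n * (v * (v * V)) ≡ u * U + suc n * (v * (v * V)) + n * (u * (v * V))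
  collect = solve-∀

-- This is `young` at n (z + s) and (n + 1) s. The two agree exactly when n z = s, that is, when the
-- new number z equals the mean of n old numbers with sum s, which is the case of equality.
amgm-step : ∀ n .{{_ : NonZero n}} s z → suc n ^ suc n * (z * s ^ n) ≤ n ^ n * (z + s) ^ suc n
amgm-step n s z = *-cancelˡ-≤ n (+-cancelʳ-≤ (n * (suc n * s * V)) _ _ (begin
  n * (suc n ^ suc n * (z * s ^ n)) + n * (suc n * s * V)            ≡⟨ cong (λ w → n * (suc n ^ suc n * (z * s ^ n)) + n * (suc n * s * w)) V≡ ⟩
  n * (suc n * M * (z * S)) + n * (suc n * s * (M * S))              ≡⟨ collect n s z M S ⟩
  suc n * (n * (z + s) * (M * S))                                    ≡⟨ cong (λ w → suc n * (n * (z + s) * w)) V≡ ⟨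
  suc n * (n * (z + s) * V)                                          ≤⟨ young n (n * (z + s)) (suc n * s) ⟩
  (n * (z + s)) ^ suc n + n * (suc n * s * V)                        ≡⟨ cong (_+ n * (suc n * s * V)) (^-distrib-* n (z + s) (suc n)) ⟩
  n * n ^ n * (z + s) ^ suc n + n * (suc n * s * V)                  ≡⟨ cong (_+ n * (suc n * s * V)) (*-assoc n (n ^ n) _) ⟩
  n * (n ^ n * (z + s) ^ suc n) + n * (suc n * s * V)                ∎))
  where
  open ≤-Reasoning
  V = (suc n * s) ^ n
  M = suc n ^ n
  S = s ^ n
  V≡ : V ≡ M * S
  V≡ = ^-distrib-* (suc n) s n
  collect : ∀ n s z M S → n * (suc n * M * (z * S)) + n * (suc n * s * (M * S)) ≡ suc n * (n * (z + s) * (M * S))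
  collect = solve-∀

amgm : ∀ zs → length zs ^ length zs * product zs ≤ sum zs ^ length zs
amgm []             = ≤-refl
amgm (z ∷ [])       = ≤-reflexive (lemma z)
  where
  lemma : ∀ z → 1 * (z * 1) ≡ (z + 0) * 1
  lemma = solve-∀
amgm (z ∷ zs@(_ ∷ _)) = *-cancelˡ-≤ (n ^ n) {{m^n≢0 n n}} (begin
  n ^ n * (suc n ^ suc n * (z * product zs))     ≡⟨ rearrange (n ^ n) (suc n ^ suc n) z (product zs) ⟩
  suc n ^ suc n * (z * (n ^ n * product zs))     ≤⟨ *-monoʳ-≤ (suc n ^ suc n) (*-monoʳ-≤ z (amgm zs)) ⟩
  suc n ^ suc n * (z * sum zs ^ n)               ≤⟨ amgm-step n (sum zs) z ⟩
  n ^ n * (z + sum zs) ^ suc n                   ∎)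
  where
  open ≤-Reasoning
  n = length zs
  rearrange : ∀ a b z p → a * (b * (z * p)) ≡ b * (z * (a * p))
  rearrange = solve-∀

-- Superadditivity of geometric means.

∏-mono : ∀ (xs : List A) {f g : A → ℕ} → (∀ x → f x ≤ g x) → ∏ xs f ≤ ∏ xs g
∏-mono []       f≤g = ≤-refl
∏-mono (x ∷ xs) f≤g = *-mono-≤ (f≤g x) (∏-mono xs f≤g)

-- Geometric means are superadditive.  Apply AM-GM to the numbers f h · ∏_{h' ≠ h} s h',
-- where s = f + g; their sum is leibniz f, and leibniz f + leibniz g = n · ∏ s.
module _ {H : Set} (s : H → ℕ) where

  leibnizTerms : (H → ℕ) → List H → List ℕ
  leibnizTerms f []       = []
  leibnizTerms f (h ∷ hs) = f h * ∏ hs s ∷ map (s h *_) (leibnizTerms f hs)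

  -- The derivative of ∏ (s h + x · f h) at x = 0. It is linear in f and equals n · ∏ s at f = s,
  -- whence `leibniz-+`.
  leibniz : (H → ℕ) → List H → ℕ
  leibniz f hs = sum (leibnizTerms f hs)

  sum-map-* : ∀ a zs → sum (map (a *_) zs) ≡ a * sum zs
  sum-map-* a []       = sym (*-zeroʳ a)
  sum-map-* a (z ∷ zs) = trans (cong (a * z +_) (sum-map-* a zs)) (sym (*-distribˡ-+ a z (sum zs)))

  product-map-* : ∀ a zs → product (map (a *_) zs) ≡ a ^ length zs * product zs
  product-map-* a []       = refl
  product-map-* a (z ∷ zs) = trans (cong (a * z *_) (product-map-* a zs)) (lemma a z (a ^ length zs) (product zs))
    where
    lemma : ∀ a z b p → a * z * (b * p) ≡ a * b * (z * p)
    lemma = solve-∀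

  length-leibnizTerms : ∀ f hs → length (leibnizTerms f hs) ≡ length hs
  length-leibnizTerms f []       = refl
  length-leibnizTerms f (h ∷ hs) = cong suc (trans (length-map (s h *_) (leibnizTerms f hs)) (length-leibnizTerms f hs))

  -- Each f h occurs in one term and each s h in all terms but one, so the terms multiply to ∏ f ·
  -- (∏ s)^(n - 1). The extra factor ∏ s avoids the exponent n - 1.
  product-leibnizTerms : ∀ f hs → product (leibnizTerms f hs) * ∏ hs s ≡ ∏ hs f * ∏ hs s ^ length hs
  product-leibnizTerms f []       = refl
  product-leibnizTerms f (h ∷ hs) = begin
    f h * P * product (map (s h *_) zs) * (s h * P)   ≡⟨ cong (λ w → f h * P * w * (s h * P)) (product-map-* (s h) zs) ⟩
    f h * P * (s h ^ length zs * product zs) * (s h * P)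
      ≡⟨ cong (λ w → f h * P * (s h ^ w * product zs) * (s h * P)) (length-leibnizTerms f hs) ⟩
    f h * P * (S * product zs) * (s h * P)            ≡⟨ regroup (f h) P S (product zs) (s h) ⟩
    f h * P * (S * s h) * (product zs * P)            ≡⟨ cong (f h * P * (S * s h) *_) (product-leibnizTerms f hs) ⟩
    f h * P * (S * s h) * (∏ hs f * P ^ length hs)    ≡⟨ collect (f h) P S (s h) (∏ hs f) (P ^ length hs) ⟩
    f h * ∏ hs f * (s h * P * (S * P ^ length hs))    ≡⟨ cong (λ w → f h * ∏ hs f * (s h * P * w)) (^-distrib-* (s h) P (length hs)) ⟨
    f h * ∏ hs f * (s h * P * (s h * P) ^ length hs)  ∎
    where
    open ≡-Reasoning
    P = ∏ hs s
    S = s h ^ length hs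
    zs = leibnizTerms f hs
    regroup : ∀ a P S z b → a * P * (S * z) * (b * P) ≡ a * P * (S * b) * (z * P)
    regroup = solve-∀
    collect : ∀ a P S b p Q → a * P * (S * b) * (p * Q) ≡ a * p * (b * P * (S * Q))
    collect = solve-∀

  leibniz-amgm : ∀ f hs → let n = length hs in
    n ^ n * (∏ hs f * ∏ hs s ^ n) ≤ leibniz f hs ^ n * ∏ hs s
  leibniz-amgm f hs = begin
    n ^ n * (∏ hs f * ∏ hs s ^ n)          ≡⟨ cong (n ^ n *_) (product-leibnizTerms f hs) ⟨
    n ^ n * (product zs * ∏ hs s)          ≡⟨ *-assoc (n ^ n) (product zs) (∏ hs s) ⟨
    n ^ n * product zs * ∏ hs s            ≤⟨ *-monoˡ-≤ (∏ hs s) (subst (λ k → k ^ k * product zs ≤ sum zs ^ k) (length-leibnizTerms f hs) (amgm zs)) ⟩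
    leibniz f hs ^ n * ∏ hs s              ∎
    where
    open ≤-Reasoning
    n = length hs
    zs = leibnizTerms f hs

  leibniz-+ : ∀ f g hs → (∀ h → f h + g h ≡ s h) → leibniz f hs + leibniz g hs ≡ length hs * ∏ hs s
  leibniz-+ f g []       f+g≡s = refl
  leibniz-+ f g (h ∷ hs) f+g≡s = begin
    f h * P + sum (map (s h *_) (leibnizTerms f hs)) + (g h * P + sum (map (s h *_) (leibnizTerms g hs)))
      ≡⟨ cong₂ (λ u v → f h * P + u + (g h * P + v)) (sum-map-* (s h) (leibnizTerms f hs)) (sum-map-* (s h) (leibnizTerms g hs)) ⟩
    f h * P + s h * leibniz f hs + (g h * P + s h * leibniz g hs)   ≡⟨ regroup (f h) (g h) (s h) P (leibniz f hs) (leibniz g hs) ⟩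
    (f h + g h) * P + s h * (leibniz f hs + leibniz g hs)           ≡⟨ cong₂ (λ u v → u * P + s h * v) (f+g≡s h) (leibniz-+ f g hs f+g≡s) ⟩
    s h * P + s h * (length hs * P)                                 ≡⟨ collect (s h) P (length hs) ⟩
    s h * P + length hs * (s h * P)                                 ∎
    where
    open ≡-Reasoning
    P = ∏ hs s
    regroup : ∀ a b c P u v → a * P + c * u + (b * P + c * v) ≡ (a + b) * P + c * (u + v)
    regroup = solve-∀
    collect : ∀ c P n → c * P + c * (n * P) ≡ c * P + n * (c * P)
    collect = solve-∀

  -- The usual proof adds two inequalities between n-th roots. Here one of them is enough: F + G = n
  -- ∏ s, so the assumed order says that the share F / (n ∏ s) is at most a / (a + b). AM-GM for f
  -- bounds ∏ f by ∏ s times the n-th power of that share, and the lower bound on ∏ f gives the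
  -- claim.
  superadditive-ordered : ∀ (hs : List H) f g a b K K′ → let n = length hs in
    (∀ h → f h + g h ≡ s h) → .{{NonZero (leibniz f hs)}} →
    b * leibniz f hs ≤ a * leibniz g hs →
    K * a ^ n ≤ K′ * ∏ hs f → K * (a + b) ^ n ≤ K′ * ∏ hs s
  superadditive-ordered hs f g a b K K′ f+g≡s bF≤aG Kaⁿ≤ =
    *-cancelʳ-≤ _ _ (F ^ n) {{m^n≢0 F n}} (begin
    K * (a + b) ^ n * F ^ n        ≡⟨ *-assoc K _ _ ⟩
    K * ((a + b) ^ n * F ^ n)      ≡⟨ cong (K *_) (^-distrib-* (a + b) F n) ⟨
    K * ((a + b) * F) ^ n          ≤⟨ *-monoʳ-≤ K (^-monoˡ-≤ n bound) ⟩
    K * (a * (n * P)) ^ n          ≡⟨ cong (K *_) (trans (^-distrib-* a (n * P) n) (cong (a ^ n *_) (^-distrib-* n P n))) ⟩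
    K * (a ^ n * (n ^ n * P ^ n))  ≡⟨ *-assoc K _ _ ⟨
    K * a ^ n * (n ^ n * P ^ n)    ≤⟨ *-monoˡ-≤ _ Kaⁿ≤ ⟩
    K′ * ∏ hs f * (n ^ n * P ^ n)  ≡⟨ regroup K′ (∏ hs f) (n ^ n) (P ^ n) ⟩
    K′ * (n ^ n * (∏ hs f * P ^ n)) ≤⟨ *-monoʳ-≤ K′ (leibniz-amgm f hs) ⟩
    K′ * (F ^ n * P)               ≡⟨ trans (cong (K′ *_) (*-comm (F ^ n) P)) (sym (*-assoc K′ P (F ^ n))) ⟩
    K′ * P * F ^ n                 ∎)
    where
    open ≤-Reasoning
    n = length hs
    F = leibniz f hs
    G = leibniz g hs
    P = ∏ hs s
    bound : (a + b) * F ≤ a * (n * P)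
    bound = begin
      (a + b) * F    ≡⟨ *-distribʳ-+ F a b ⟩
      a * F + b * F  ≤⟨ +-monoʳ-≤ (a * F) bF≤aG ⟩
      a * F + a * G  ≡⟨ *-distribˡ-+ a F G ⟨
      a * (F + G)    ≡⟨ cong (a *_) (leibniz-+ f g hs f+g≡s) ⟩
      a * (n * P)    ∎
    regroup : ∀ k p m q → k * p * (m * q) ≡ k * (m * (p * q))
    regroup = solve-∀

  leibniz-positive : ∀ f hs .{{_ : NonZero (length hs)}} → (∀ h → f h ≤ s h) →
    0 < ∏ hs f → NonZero (leibniz f hs)
  leibniz-positive f hs@(_ ∷ _) f≤s 0<∏f = go (leibniz f hs) (leibniz-amgm f hs)
    where
    n = length hs
    instance
      ∏f≢0 : NonZero (∏ hs f)
      ∏f≢0 = >-nonZero 0<∏f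
      ∏s≢0 : NonZero (∏ hs s)
      ∏s≢0 = >-nonZero (<-≤-trans 0<∏f (∏-mono hs f≤s))
    0<lhs : 0 < n ^ n * (∏ hs f * ∏ hs s ^ n)
    0<lhs = >-nonZero⁻¹ _ {{m*n≢0 _ _ {{m^n≢0 n n}} {{m*n≢0 _ _ {{∏f≢0}} {{m^n≢0 (∏ hs s) n}}}}}}
    go : ∀ F → n ^ n * (∏ hs f * ∏ hs s ^ n) ≤ F ^ n * ∏ hs s → NonZero F
    go zero    lhs≤0 with () ← <-≤-trans 0<lhs lhs≤0
    go (suc F) _ = _

positive-factor : ∀ K a n K′ {p} .{{_ : NonZero K}} .{{_ : NonZero a}} → K * a ^ n ≤ K′ * p → 0 < p
positive-factor K a n K′ {zero} Kaⁿ≤ =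
  <-≤-trans (*-mono-≤ (>-nonZero⁻¹ K) (m^n>0 a n)) (subst (K * a ^ n ≤_) (*-zeroʳ K′) Kaⁿ≤)
positive-factor K a n K′ {suc p} _ = z<s

-- `K` and `K′` stand for a rational constant K′ / K, which changes from one coordinate to the next
-- in the inductions below.
superadditive : ∀ {H : Set} (hs : List H) .{{_ : NonZero (length hs)}} (f g : H → ℕ) a b K K′ → let n = length hs in
  K * a ^ n ≤ K′ * ∏ hs f → K * b ^ n ≤ K′ * ∏ hs g → K * (a + b) ^ n ≤ K′ * ∏ hs (λ h → f h + g h)
superadditive hs f g a b zero K′ Kaⁿ≤ Kbⁿ≤ = z≤n
-- If a or b is 0, its hypothesis gives no lower bound on a product; the other one suffices by
-- monotonicity.
superadditive hs f g zero b (suc K) K′ Kaⁿ≤ Kbⁿ≤ =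
  ≤-trans Kbⁿ≤ (*-monoʳ-≤ K′ (∏-mono hs (λ h → m≤n+m (g h) (f h))))
superadditive hs f g (suc a) zero K@(suc _) K′ Kaⁿ≤ Kbⁿ≤ rewrite +-identityʳ a =
  ≤-trans Kaⁿ≤ (*-monoʳ-≤ K′ (∏-mono hs (λ h → m≤m+n (f h) (g h))))
superadditive {H} hs f g a@(suc _) b@(suc _) K@(suc _) K′ Kaⁿ≤ Kbⁿ≤ = result
  where
  n = length hs
  s : H → ℕ
  s h = f h + g h
  instance
    F≢0 : NonZero (leibniz s f hs)
    F≢0 = leibniz-positive s f hs (λ h → m≤m+n (f h) (g h)) (positive-factor K a n K′ Kaⁿ≤)
    G≢0 : NonZero (leibniz s g hs)
    G≢0 = leibniz-positive s g hs (λ h → m≤n+m (g h) (f h)) (positive-factor K b n K′ Kbⁿ≤)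
  result : K * (a + b) ^ n ≤ K′ * ∏ hs s
  result with ≤-total (b * leibniz s f hs) (a * leibniz s g hs)
  ... | inj₁ bF≤aG = superadditive-ordered s hs f g a b K K′ (λ _ → refl) bF≤aG Kaⁿ≤
  ... | inj₂ aG≤bF = subst (λ w → K * w ^ n ≤ K′ * ∏ hs s) (+-comm b a)
                       (superadditive-ordered s hs g f b a K K′ (λ h → +-comm (g h) (f h)) aG≤bF Kbⁿ≤)

-- Finite sums and sums over tuples.

∑-cong : ∀ (xs : List A) {f g : A → ℕ} → (∀ x → f x ≡ g x) → ∑ xs f ≡ ∑ xs g
∑-cong xs f≡g = cong sum (map-cong f≡g xs)

∑-mono : ∀ (xs : List A) {f g : A → ℕ} → (∀ x → f x ≤ g x) → ∑ xs f ≤ ∑ xs g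
∑-mono []       f≤g = z≤n
∑-mono (x ∷ xs) f≤g = +-mono-≤ (f≤g x) (∑-mono xs f≤g)

∑-const : ∀ (xs : List A) k → ∑ xs (const k) ≡ length xs * k
∑-const []       k = refl
∑-const (x ∷ xs) k = cong (k +_) (∑-const xs k)

∑-*ˡ : ∀ k (xs : List A) (f : A → ℕ) → ∑ xs (λ x → k * f x) ≡ k * ∑ xs f
∑-*ˡ k []       f = sym (*-zeroʳ k)
∑-*ˡ k (x ∷ xs) f = trans (cong (k * f x +_) (∑-*ˡ k xs f)) (sym (*-distribˡ-+ k (f x) (∑ xs f)))

∑-*ʳ : ∀ k (xs : List A) (f : A → ℕ) → ∑ xs (λ x → f x * k) ≡ ∑ xs f * k
∑-*ʳ k xs f = trans (∑-cong xs (λ x → *-comm (f x) k)) (trans (∑-*ˡ k xs f) (*-comm k (∑ xs f)))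

∑-+ : ∀ (xs : List A) (f g : A → ℕ) → ∑ xs (λ x → f x + g x) ≡ ∑ xs f + ∑ xs g
∑-+ []       f g = refl
∑-+ (x ∷ xs) f g = trans (cong (f x + g x +_) (∑-+ xs f g)) (lemma (f x) (g x) (∑ xs f) (∑ xs g))
  where
  lemma : ∀ a b u v → a + b + (u + v) ≡ a + u + (b + v)
  lemma = solve-∀

∑-swap : ∀ (xs : List A) (ys : List B) (f : A → B → ℕ) →
  ∑ xs (λ x → ∑ ys (f x)) ≡ ∑ ys (λ y → ∑ xs (λ x → f x y))
∑-swap []       ys f = sym (trans (∑-const ys 0) (*-zeroʳ (length ys)))
∑-swap (x ∷ xs) ys f = trans (cong (∑ ys (f x) +_) (∑-swap xs ys f)) (sym (∑-+ ys (f x) _))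

∑-++ : ∀ (xs ys : List A) (f : A → ℕ) → ∑ (xs ++ˡ ys) f ≡ ∑ xs f + ∑ ys f
∑-++ xs ys f = trans (cong sum (map-++ f xs ys)) (sum-++ (map f xs) (map f ys))

∏-++ : ∀ (xs ys : List A) (f : A → ℕ) → ∏ (xs ++ˡ ys) f ≡ ∏ xs f * ∏ ys f
∏-++ xs ys f = trans (cong product (map-++ f xs ys)) (product-++ (map f xs) (map f ys))

∑-map : ∀ (g : A → B) (xs : List A) (f : B → ℕ) → ∑ (map g xs) f ≡ ∑ xs (f ∘ g)
∑-map g []       f = refl
∑-map g (x ∷ xs) f = cong (f (g x) +_) (∑-map g xs f)

∑-cartesian : ∀ {C : Set} (p : A → B → C) (xs : List A) (ys : List B) (f : C → ℕ) →
  ∑ (cartesianProductWith p xs ys) f ≡ ∑ xs (λ x → ∑ ys (λ y → f (p x y)))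
∑-cartesian p []       ys f = refl
∑-cartesian p (x ∷ xs) ys f =
  trans (∑-++ (map (p x) ys) (cartesianProductWith p xs ys) f)
        (cong₂ _+_ (∑-map (p x) ys f) (∑-cartesian p xs ys f))

tuples : List X → ∀ L → List (Vec X L)
tuples xs zero    = [] ∷ []
tuples xs (suc L) = cartesianProductWith _∷_ xs (tuples xs L)

∑-tuples-suc : ∀ (xs : List X) L (f : Vec X (suc L) → ℕ) →
  ∑ (tuples xs (suc L)) f ≡ ∑ xs (λ x → ∑ (tuples xs L) (λ a → f (x ∷ a)))
∑-tuples-suc xs L f = ∑-cartesian _∷_ xs (tuples xs L) f

-- Hölder's and Finner's inequalities.

module _ {X : Set} where

  -- Each point of `xs` is one application of superadditivity, with F at that point and the sum of F
  -- over the remaining points as the two bases.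
  hölder : ∀ (hs : List (X → ℕ)) .{{_ : NonZero (length hs)}} xs (F : X → ℕ) K K′ → let n = length hs in
    (∀ x → K * F x ^ n ≤ K′ * ∏ hs (_$ x)) → K * ∑ xs F ^ n ≤ K′ * ∏ hs (∑ xs)
  hölder hs@(_ ∷ _) []       F K K′ Fⁿ≤ = ≤-trans (≤-reflexive (*-zeroʳ K)) z≤n
  hölder hs (x ∷ xs) F K K′ Fⁿ≤ = superadditive hs (_$ x) (∑ xs) (F x) (∑ xs F) K K′ (Fⁿ≤ x) (hölder hs xs F K K′ Fⁿ≤)

  ∏-replicate : ∀ r (c : A) (f : A → ℕ) → ∏ (replicate r c) f ≡ f c ^ r
  ∏-replicate zero    c f = refl
  ∏-replicate (suc r) c f = cong (f c *_) (∏-replicate r c f)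

  -- Missing functions are replaced by the constant 1, whose sum is q. Powers of q on both sides
  -- express this without the exponent n - d.
  hölder-padded : ∀ (hs : List (X → ℕ)) n .{{_ : NonZero n}} xs (F : X → ℕ) K K′ → length hs ≤ n →
    (∀ x → K * F x ^ n ≤ K′ * ∏ hs (_$ x)) →
    K * ∑ xs F ^ n * length xs ^ length hs ≤ K′ * length xs ^ n * ∏ hs (∑ xs)
  hölder-padded hs n xs F K K′ d≤n Fⁿ≤ = begin
    K * ∑ xs F ^ n * q ^ d               ≡⟨ cong (λ m → K * ∑ xs F ^ m * q ^ d) (sym len) ⟩
    K * ∑ xs F ^ length padded * q ^ d   ≤⟨ *-monoˡ-≤ (q ^ d) (hölder padded {{subst NonZero (sym len) it}} xs F K K′ bound) ⟩
    K′ * ∏ padded (∑ xs) * q ^ d         ≡⟨ cong (λ p → K′ * p * q ^ d) ∏-padded ⟩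
    K′ * (∏ hs (∑ xs) * q ^ r) * q ^ d   ≡⟨ regroup K′ (∏ hs (∑ xs)) (q ^ r) (q ^ d) ⟩
    K′ * (q ^ d * q ^ r) * ∏ hs (∑ xs)   ≡⟨ cong (λ p → K′ * p * ∏ hs (∑ xs)) (^-distribˡ-+-* q d r) ⟨
    K′ * q ^ (d + r) * ∏ hs (∑ xs)       ≡⟨ cong (λ m → K′ * q ^ m * ∏ hs (∑ xs)) (m+[n∸m]≡n d≤n) ⟩
    K′ * q ^ n * ∏ hs (∑ xs)             ∎
    where
    open ≤-Reasoning
    q = length xs
    d = length hs
    r = n ∸ d
    padded = hs ++ˡ replicate r (const 1)
    len : length padded ≡ n
    len = trans (length-++ hs) (trans (cong (d +_) (length-replicate r)) (m+[n∸m]≡n d≤n))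
    bound : ∀ x → K * F x ^ length padded ≤ K′ * ∏ padded (_$ x)
    bound x = subst₂ (λ m p → K * F x ^ m ≤ K′ * p) (sym len)
      (sym (trans (∏-++ hs (replicate r (const 1)) (_$ x))
           (trans (cong (∏ hs (_$ x) *_) (trans (∏-replicate r (const 1) (_$ x)) (^-zeroˡ r))) (*-identityʳ _))))
      (Fⁿ≤ x)
    ∏-padded : ∏ padded (∑ xs) ≡ ∏ hs (∑ xs) * q ^ r
    ∏-padded = trans (∏-++ hs (replicate r (const 1)) (∑ xs))
      (cong (∏ hs (∑ xs) *_) (trans (∏-replicate r (const 1) (∑ xs)) (cong (_^ r) (trans (∑-const xs 1) (*-identityʳ q)))))
    regroup : ∀ k p u v → k * (p * u) * v ≡ k * (v * u) * p
    regroup = solve-∀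

  -- Averaging a constant function changes nothing, so only the functions that depend on the
  -- summation variable use up Hölder exponents; acc collects these.
  hölder-masked : ∀ (x₀ : X) (is : List I) (d : I → Bool) (h : I → X → ℕ) →
    (∀ i → d i ≡ false → ∀ x y → h i x ≡ h i y) →
    ∀ (acc : List (X → ℕ)) n .{{_ : NonZero n}} xs (F : X → ℕ) K K′ →
    length acc + ∑ is (bit ∘ d) ≤ n →
    (∀ x → K * F x ^ n ≤ K′ * (∏ acc (_$ x) * ∏ is (λ i → h i x))) →
    K * ∑ xs F ^ n * length xs ^ (length acc + length is) ≤
      K′ * length xs ^ n * (∏ acc (∑ xs) * ∏ is (λ i → ∑ xs (h i)))
  hölder-masked x₀ [] d h const-h acc n xs F K K′ deg Fⁿ≤
    rewrite +-identityʳ (length acc) | *-identityʳ (∏ acc (∑ xs)) =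
    hölder-padded acc n xs F K K′ deg (λ x → subst (λ p → K * F x ^ n ≤ K′ * p) (*-identityʳ _) (Fⁿ≤ x))
  hölder-masked x₀ (i ∷ is) d h const-h acc n xs F K K′ deg Fⁿ≤ with d i in di
  ... | true = subst₂ (λ e p → K * ∑ xs F ^ n * length xs ^ e ≤ K′ * length xs ^ n * p)
                 (sym (+-suc (length acc) (length is)))
                 (swap (∑ xs (h i)) (∏ acc (∑ xs)) _)
                 (hölder-masked x₀ is d h const-h (h i ∷ acc) n xs F K K′
                   (subst (_≤ n) (+-suc (length acc) _) deg)
                   (λ x → subst (λ p → K * F x ^ n ≤ K′ * p) (sym (swap (h i x) (∏ acc (_$ x)) _)) (Fⁿ≤ x)))
    where
    swap : ∀ a b c → a * b * c ≡ b * (a * c)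
    swap = solve-∀
  ... | false = begin
    K * ∑ xs F ^ n * q ^ (length acc + suc (length is))    ≡⟨ cong (λ e → K * ∑ xs F ^ n * q ^ e) (+-suc (length acc) (length is)) ⟩
    K * ∑ xs F ^ n * (q * q ^ (length acc + length is))    ≡⟨ pull (K * ∑ xs F ^ n) q _ ⟩
    -- A function constant in the summation variable is moved into `K′` through its value at `x₀`;
    -- its own sum is q times that value.
    q * (K * ∑ xs F ^ n * q ^ (length acc + length is))    ≤⟨ *-monoʳ-≤ q (hölder-masked x₀ is d h const-h acc n xs F K (K′ * h i x₀) deg bound) ⟩
    q * (K′ * h i x₀ * q ^ n * (∏ acc (∑ xs) * P))         ≡⟨ regroup q K′ (h i x₀) (q ^ n) (∏ acc (∑ xs)) P ⟩
    K′ * q ^ n * (∏ acc (∑ xs) * (q * h i x₀ * P))         ≡⟨ cong (λ p → K′ * q ^ n * (∏ acc (∑ xs) * (p * P))) ∑h ⟨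
    K′ * q ^ n * (∏ acc (∑ xs) * (∑ xs (h i) * P))         ∎
    where
    open ≤-Reasoning
    q = length xs
    P = ∏ is (λ i → ∑ xs (h i))
    ∑h : ∑ xs (h i) ≡ q * h i x₀
    ∑h = trans (∑-cong xs (λ x → const-h i di x x₀)) (∑-const xs (h i x₀))
    bound : ∀ x → K * F x ^ n ≤ K′ * h i x₀ * (∏ acc (_$ x) * ∏ is (λ i → h i x))
    bound x = ≤-trans (Fⁿ≤ x) (≤-reflexive
      (trans (cong (λ w → K′ * (∏ acc (_$ x) * (w * ∏ is (λ i → h i x)))) (const-h i di x x₀))
             (assoc K′ (∏ acc (_$ x)) (h i x₀) _)))
      where
      assoc : ∀ k a c p → k * (a * (c * p)) ≡ k * c * (a * p)
      assoc = solve-∀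
    pull : ∀ a q b → a * (q * b) ≡ q * (a * b)
    pull = solve-∀
    regroup : ∀ q k c m a p → q * (k * c * m * (a * p)) ≡ k * m * (a * (q * c * p))
    regroup = solve-∀

  AgreeOn : ∀ {L} → (ℕ → Bool) → Vec X L → Vec X L → Set
  AgreeOn N a a′ = ∀ y → T (N (toℕ y)) → lookup a y ≡ lookup a′ y

  DependsOnlyOn : ∀ {L} → (ℕ → Bool) → (Vec X L → ℕ) → Set
  DependsOnlyOn N h = ∀ a a′ → AgreeOn N a a′ → h a ≡ h a′

  -- In terms of averages the claim is E[F]^n ≤ ∏ E[h i]; the powers of q clear the denominators.
  -- For a fixed first letter, induction bounds the partial sum over the other letters. The partial
  -- sum of h i varies with the first letter only if `N i 0` holds, so the degree condition at
  -- coordinate 0 is what `hölder-masked` requires.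
  finner : ∀ (x₀ : X) (xs : List X) n .{{_ : NonZero n}} (is : List I) L (N : I → ℕ → Bool) (h : I → Vec X L → ℕ) F →
    (∀ i → DependsOnlyOn (N i) (h i)) → (∀ y → ∑ is (λ i → bit (N i y)) ≤ n) →
    (∀ a → F a ^ n ≤ ∏ is (λ i → h i a)) →
    let q = length xs in
    q ^ (length is * L) * ∑ (tuples xs L) F ^ n ≤ q ^ (L * n) * ∏ is (λ i → ∑ (tuples xs L) (h i))
  finner x₀ xs n is zero N h F dep deg Fⁿ≤ rewrite *-zeroʳ (length is) =
    subst₂ _≤_ (sym (trans (+-identityʳ _) (cong (_^ n) (+-identityʳ (F [])))))
               (sym (trans (+-identityʳ _) (∏-cong is (λ i → +-identityʳ (h i [])))))
               (Fⁿ≤ [])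
    where
    ∏-cong : ∀ (is : List I) {f g : I → ℕ} → (∀ i → f i ≡ g i) → ∏ is f ≡ ∏ is g
    ∏-cong is f≡g = cong product (map-cong f≡g is)
  finner {I = I} x₀ xs n is (suc L) N h F dep deg Fⁿ≤ = begin
    q ^ (k * suc L) * ∑ (tuples xs (suc L)) F ^ n
      ≡⟨ cong₂ (λ e s → q ^ e * s ^ n) (trans (*-suc k L) (+-comm k (k * L))) (∑-tuples-suc xs L F) ⟩
    q ^ (k * L + k) * ∑ xs F′ ^ n
      ≡⟨ trans (cong (_* ∑ xs F′ ^ n) (^-distribˡ-+-* q (k * L) k)) (regroup (q ^ (k * L)) (q ^ k) _) ⟩
    q ^ (k * L) * ∑ xs F′ ^ n * q ^ k
      ≤⟨ hölder-masked x₀ is (λ i → N i 0) h′ const-h′ [] n xs F′ (q ^ (k * L)) (q ^ (L * n)) (deg 0)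
           (λ x → subst (λ p → q ^ (k * L) * F′ x ^ n ≤ q ^ (L * n) * p) (sym (+-identityʳ _))
             (finner x₀ xs n is L (λ i → N i ∘ suc) (λ i a → h i (x ∷ a)) (λ a → F (x ∷ a))
                (λ i a a′ agree → dep i (x ∷ a) (x ∷ a′) λ { zero _ → refl ; (suc y) → agree y }) (λ y → deg (suc y)) (λ a → Fⁿ≤ (x ∷ a)))) ⟩
    q ^ (L * n) * q ^ n * (1 * ∏ is (λ i → ∑ xs (h′ i)))
      ≡⟨ cong₂ _*_ (trans (*-comm (q ^ (L * n)) (q ^ n)) (sym (^-distribˡ-+-* q n (L * n)))) (+-identityʳ _) ⟩
    q ^ (n + L * n) * ∏ is (λ i → ∑ xs (h′ i))
      ≡⟨ cong (q ^ (n + L * n) *_) (cong product (map-cong (λ i → ∑-tuples-suc xs L (h i)) is)) ⟨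
    q ^ (suc L * n) * ∏ is (λ i → ∑ (tuples xs (suc L)) (h i)) ∎
    where
    open ≤-Reasoning
    q = length xs
    k = length is
    F′ : X → ℕ
    F′ x = ∑ (tuples xs L) (λ a → F (x ∷ a))
    h′ : I → X → ℕ
    h′ i x = ∑ (tuples xs L) (λ a → h i (x ∷ a))
    const-h′ : ∀ i → N i 0 ≡ false → ∀ x y → h′ i x ≡ h′ i y
    const-h′ i Ni0 x y = ∑-cong (tuples xs L) λ a →
      dep i (x ∷ a) (y ∷ a) λ { zero Ni0≡true → ⊥-elim (subst T Ni0 Ni0≡true) ; (suc z) _ → refl }
    regroup : ∀ a b c → a * b * c ≡ a * c * b
    regroup = solve-∀

-- Conditions on the masked coordinates of a tuple.

bit-∧ : ∀ a b → bit (a ∧ b) ≡ bit a * bit b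
bit-∧ true  b = sym (+-identityʳ (bit b))
bit-∧ false b = refl

bit-mono : ∀ {a b} → (T a → T b) → bit a ≤ bit b
bit-mono {false} {b}     a⇒b = z≤n
bit-mono {true}  {true}  a⇒b = ≤-refl
bit-mono {true}  {false} a⇒b = ⊥-elim (a⇒b tt)

bit-T : ∀ {b} → T b → bit b ≡ 1
bit-T {true} _ = refl

term≤∑ : ∀ {xs : List A} (f : A → ℕ) {x} → x ∈ˡ xs → f x ≤ ∑ xs f
term≤∑ f (here refl) = m≤m+n _ _
term≤∑ f (there x∈)  = ≤-trans (term≤∑ f x∈) (m≤n+m _ _)

trues : (ℕ → Bool) → ℕ → ℕ
trues N zero    = 0
trues N (suc L) = bit (N 0) + trues (N ∘ suc) L

module _ {X : Set} where

  allMasked : ∀ {L} → (X → Bool) → (ℕ → Bool) → Vec X L → Bool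
  allMasked p N []      = true
  allMasked p N (x ∷ a) = (not (N 0) ∨ p x) ∧ allMasked p (N ∘ suc) a

  allMasked⁺ : ∀ {L} p N (a : Vec X L) → (∀ y → T (N (toℕ y)) → T (p (lookup a y))) → T (allMasked p N a)
  allMasked⁺ p N []      all = tt
  allMasked⁺ p N (x ∷ a) all with N 0 in N0
  ... | false = allMasked⁺ p (N ∘ suc) a (all ∘ suc)
  ... | true  = Equivalence.from T-∧ (all zero (subst T (sym N0) tt) , allMasked⁺ p (N ∘ suc) a (all ∘ suc))

  allMasked⁻ : ∀ {L} p N (a : Vec X L) → T (allMasked p N a) → ∀ y → T (N (toℕ y)) → T (p (lookup a y))
  allMasked⁻ p N (x ∷ a) ok y Ny with N 0 in N0
  allMasked⁻ p N (x ∷ a) ok (suc y) Ny | false = allMasked⁻ p (N ∘ suc) a ok y Ny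
  allMasked⁻ p N (x ∷ a) ok zero    Ny | false = ⊥-elim (subst T N0 Ny)
  allMasked⁻ p N (x ∷ a) ok zero    Ny | true  = proj₁ (Equivalence.to T-∧ ok)
  allMasked⁻ p N (x ∷ a) ok (suc y) Ny | true  = allMasked⁻ p (N ∘ suc) a (proj₂ (Equivalence.to (T-∧ {p x}) ok)) y Ny

  allMasked-cong : ∀ {L} p N (a a′ : Vec X L) → AgreeOn N a a′ → bit (allMasked p N a) ≡ bit (allMasked p N a′)
  allMasked-cong p N a a′ agree = ≤-antisym
    (bit-mono λ ok → allMasked⁺ p N a′ λ y Ny → subst (T ∘ p) (agree y Ny) (allMasked⁻ p N a ok y Ny))
    (bit-mono λ ok → allMasked⁺ p N a λ y Ny → subst (T ∘ p) (sym (agree y Ny)) (allMasked⁻ p N a′ ok y Ny))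

  -- Coordinates are independent, so the proportion of good tuples is (m / q)^τ; multiplied out, no
  -- difference of exponents appears.
  count-allMasked : ∀ (xs : List X) p N L →
    length xs ^ trues N L * ∑ (tuples xs L) (bit ∘ allMasked p N) ≡ length xs ^ L * ∑ xs (bit ∘ p) ^ trues N L
  count-allMasked xs p N zero    = refl
  count-allMasked xs p N (suc L) = begin
    q ^ (bit (N 0) + τ) * ∑ (tuples xs (suc L)) (bit ∘ allMasked p N)
      ≡⟨ cong₂ _*_ (^-distribˡ-+-* q (bit (N 0)) τ) split ⟩
    q ^ bit (N 0) * q ^ τ * (∑ xs (λ x → bit (not (N 0) ∨ p x)) * R)
      ≡⟨ regroup (q ^ bit (N 0)) (q ^ τ) _ R ⟩
    q ^ bit (N 0) * ∑ xs (λ x → bit (not (N 0) ∨ p x)) * (q ^ τ * R)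
      ≡⟨ cong₂ _*_ (head (N 0)) (count-allMasked xs p (N ∘ suc) L) ⟩
    q * m ^ bit (N 0) * (q ^ L * m ^ τ)
      ≡⟨ regroup q (m ^ bit (N 0)) (q ^ L) (m ^ τ) ⟩
    q * q ^ L * (m ^ bit (N 0) * m ^ τ)
      ≡⟨ cong (q * q ^ L *_) (^-distribˡ-+-* m (bit (N 0)) τ) ⟨
    q * q ^ L * m ^ (bit (N 0) + τ) ∎
    where
    open ≡-Reasoning
    q = length xs
    m = ∑ xs (bit ∘ p)
    τ = trues (N ∘ suc) L
    R = ∑ (tuples xs L) (bit ∘ allMasked p (N ∘ suc))
    split : ∑ (tuples xs (suc L)) (bit ∘ allMasked p N) ≡ ∑ xs (λ x → bit (not (N 0) ∨ p x)) * R
    split = trans (∑-tuples-suc xs L _)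
      (trans (∑-cong xs (λ x → trans (∑-cong (tuples xs L) (λ a → bit-∧ (not (N 0) ∨ p x) (allMasked p (N ∘ suc) a))) (∑-*ˡ (bit (not (N 0) ∨ p x)) (tuples xs L) (bit ∘ allMasked p (N ∘ suc)))))
             (∑-*ʳ R xs (λ x → bit (not (N 0) ∨ p x))))
    head : ∀ b → q ^ bit b * ∑ xs (λ x → bit (not b ∨ p x)) ≡ q * m ^ bit b
    head true  = cong₂ _*_ (*-identityʳ q) (sym (*-identityʳ m))
    head false = trans (+-identityʳ _) (∑-const xs 1)
    regroup : ∀ a b c d → a * b * (c * d) ≡ a * c * (b * d)
    regroup = solve-∀

∑-allFin-suc : ∀ n (f : Fin (suc n) → ℕ) → ∑ (allFin (suc n)) f ≡ f zero + ∑ (allFin n) (f ∘ suc)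
∑-allFin-suc n f = cong (λ ys → f zero + sum ys) (trans (map-tabulate suc f) (sym (map-tabulate id (f ∘ suc))))

length-allFin : ∀ n → length (allFin n) ≡ n
length-allFin n = length-tabulate id

count-≥ : ∀ n m → ∑ (allFin n) (λ x → bit (m ≤ᵇ toℕ x)) ≤ n ∸ m
count-≥ zero    m       = z≤n
count-≥ (suc n) zero    = ≤-reflexive (trans (∑-const (allFin (suc n)) 1) (trans (*-identityʳ _) (length-allFin (suc n))))
count-≥ (suc n) (suc m) = begin
  ∑ (allFin (suc n)) (λ x → bit (suc m ≤ᵇ toℕ x))  ≡⟨ ∑-allFin-suc n (λ x → bit (suc m ≤ᵇ toℕ x)) ⟩
  ∑ (allFin n) (λ x → bit (suc m ≤ᵇ suc (toℕ x)))  ≤⟨ ∑-mono (allFin n) (λ x → bit-mono (≤⇒≤ᵇ ∘ s≤s⁻¹ ∘ ≤ᵇ⇒≤ (suc m) (suc (toℕ x)))) ⟩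
  ∑ (allFin n) (λ x → bit (m ≤ᵇ toℕ x))            ≤⟨ count-≥ n m ⟩
  n ∸ m                                            ∎
  where open ≤-Reasoning

-- The constant C and the sum at one letter of B.

c² : ℕ → ℕ
c² q = (q + 2) * (q + 2) / 4

uv≤c² : ∀ q u v → u + v ≡ q + 2 → u * v ≤ c² q
uv≤c² q u v u+v≡q+2 = begin
  u * v                      ≡⟨ m*n/n≡m (u * v) 4 ⟨
  u * v * 4 / 4              ≤⟨ /-monoˡ-≤ 4 (≤-trans 4uv≤ (≤-reflexive (cong (λ s → s * s) u+v≡q+2))) ⟩
  (q + 2) * (q + 2) / 4      ∎
  where
  open ≤-Reasoning
  4uv≤ : u * v * 4 ≤ (u + v) * (u + v)
  4uv≤ = begin
    u * v * 4                          ≡⟨ halve u v ⟩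
    2 * (u * v) + 2 * (u * v)          ≤⟨ +-monoˡ-≤ (2 * (u * v)) (2uv≤u²+v² u v) ⟩
    u * u + v * v + 2 * (u * v)        ≡⟨ square u v ⟩
    (u + v) * (u + v)                  ∎
    where
    halve : ∀ u v → u * v * 4 ≡ 2 * (u * v) + 2 * (u * v)
    halve = solve-∀
    square : ∀ u v → u * u + v * v + 2 * (u * v) ≡ (u + v) * (u + v)
    square = solve-∀

module _ (q : ℕ) where

  heavy : Fin q → Fin q → Bool
  heavy b x = q ≤ᵇ suc (toℕ b) + suc (toℕ x)

  atLeast : Fin q → Fin q → Bool
  atLeast μ x = toℕ μ ≤ᵇ toℕ x

  choices : ∀ {L} → (ℕ → Bool) → Vec (Fin q) L → ℕ
  choices N a = ∑ (allFin q) (λ b → bit (allMasked (heavy b) N a))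

  -- The indicator of "the minimum of the neighbours is μ" is not a product over the neighbours, but
  -- that of "all neighbours are at least μ" is. With the latter the sum over all tuples is
  -- explicit, and summing over μ costs only a factor q.
  majorant : ∀ {L} → ℕ → (ℕ → Bool) → Vec (Fin q) L → ℕ
  majorant n N a = ∑ (allFin q) (λ μ → bit (allMasked (atLeast μ) N a) * (2 + toℕ μ) ^ n)

  majorant-dependsOnlyOn : ∀ {L} n N → DependsOnlyOn {L = L} N (majorant n N)
  majorant-dependsOnlyOn n N a a′ agree =
    ∑-cong (allFin q) (λ μ → cong (_* (2 + toℕ μ) ^ n) (allMasked-cong (atLeast μ) N a a′ agree))

  masked-minimum : ∀ {L} N (a : Vec (Fin q) L) →
    trues N L ≡ 0 ⊎ (∃ λ y₀ → T (N (toℕ y₀)) × ∀ y → T (N (toℕ y)) → toℕ (lookup a y₀) ≤ toℕ (lookup a y))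
  masked-minimum N []      = inj₁ refl
  masked-minimum N (x ∷ a) with masked-minimum (N ∘ suc) a | N 0 in N0
  ... | inj₁ none              | false = inj₁ none
  ... | inj₂ (y₀ , Ny₀ , min)  | false = inj₂ (suc y₀ , Ny₀ , λ { zero Ny → ⊥-elim (subst T N0 Ny) ; (suc y) → min y })
  ... | inj₁ none              | true  = inj₂ (zero , subst T (sym N0) tt , λ { zero _ → ≤-refl ; (suc y) Ny → ⊥-elim (empty none y Ny) })
    where
    empty : ∀ {N L} → trues N L ≡ 0 → ∀ (y : Fin L) → T (N (toℕ y)) → ⊥
    empty {N} eq zero    Ny with N 0
    empty     ()  zero    Ny | true
    empty {N} eq (suc y) Ny = empty (m+n≡0⇒n≡0 (bit (N 0)) eq) y Ny
  ... | inj₂ (y₀ , Ny₀ , min)  | true  with ≤-total (toℕ x) (toℕ (lookup a y₀))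
  ...   | inj₁ x≤ = inj₂ (zero , subst T (sym N0) tt , λ { zero _ → ≤-refl ; (suc y) Ny → ≤-trans x≤ (min y Ny) })
  ...   | inj₂ ≤x = inj₂ (suc y₀ , Ny₀ , λ { zero _ → ≤x ; (suc y) → min y })

  choices^n≤majorant : ∀ {L} n N (a : Vec (Fin q) L) → .{{NonZero (trues N L)}} → choices N a ^ n ≤ majorant n N a
  choices^n≤majorant {L} n N a with masked-minimum N a
  ... | inj₁ none = ⊥-elim (≢-nonZero⁻¹ (trues N L) none)
  ... | inj₂ (y₀ , Ny₀ , min) = begin
    choices N a ^ n                                            ≤⟨ ^-monoˡ-≤ n choices≤ ⟩
    (2 + toℕ μ) ^ n                                            ≡⟨ *-identityˡ _ ⟨
    1 * (2 + toℕ μ) ^ n                                        ≡⟨ cong (_* (2 + toℕ μ) ^ n) (bit-T (allMasked⁺ (atLeast μ) N a (λ y Ny → ≤⇒≤ᵇ (min y Ny)))) ⟨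
    bit (allMasked (atLeast μ) N a) * (2 + toℕ μ) ^ n          ≤⟨ term≤∑ (λ μ → bit (allMasked (atLeast μ) N a) * (2 + toℕ μ) ^ n) (∈-allFin μ) ⟩
    majorant n N a                                             ∎
    where
    open ≤-Reasoning
    -- The smallest neighbour, whose term in the majorant already suffices. Letters are `toℕ` plus
    -- one, so an admissible b satisfies b + μ + 2 ≥ q, which leaves at most μ + 2 values: the M + 1
    -- of the overview.
    μ = lookup a y₀
    q∸μ≤ : ∀ b → T (allMasked (heavy b) N a) → q ∸ (2 + toℕ μ) ≤ toℕ b
    q∸μ≤ b ok = m≤n+o⇒m∸n≤o q (2 + toℕ μ) (≤-trans (≤ᵇ⇒≤ q _ (allMasked⁻ (heavy b) N a ok y₀ Ny₀)) (≤-reflexive (comm (toℕ b) (toℕ μ))))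
      where
      comm : ∀ b μ → suc b + suc μ ≡ 2 + μ + b
      comm = solve-∀
    choices≤ : choices N a ≤ 2 + toℕ μ
    choices≤ = begin
      choices N a                                           ≤⟨ ∑-mono (allFin q) (λ b → bit-mono (≤⇒≤ᵇ ∘ q∸μ≤ b)) ⟩
      ∑ (allFin q) (λ b → bit (q ∸ (2 + toℕ μ) ≤ᵇ toℕ b))      ≤⟨ count-≥ q (q ∸ (2 + toℕ μ)) ⟩
      q ∸ (q ∸ (2 + toℕ μ))                                 ≤⟨ m≤n+o⇒m∸n≤o q (q ∸ (2 + toℕ μ)) (subst (q ≤_) (+-comm (2 + toℕ μ) _) (m≤n+m∸n q (2 + toℕ μ))) ⟩
      2 + toℕ μ                                             ∎

  -- Once the sums are exchanged, the tuples whose n masked letters are all at least μ form at most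
  -- the proportion ((q - μ) / q)^n, and (q - μ) + (μ + 2) = q + 2 lets `uv≤c²` bound each term.
  ∑-majorant : ∀ L N → let n = trues N L in
    q ^ n * ∑ (tuples (allFin q) L) (majorant n N) ≤ q ^ L * (q * c² q ^ n)
  ∑-majorant L N = begin
    q ^ n * ∑ (tuples (allFin q) L) (majorant n N)
      ≡⟨ cong (q ^ n *_) (∑-swap (tuples (allFin q) L) (allFin q) _) ⟩
    q ^ n * ∑ (allFin q) (λ μ → ∑ (tuples (allFin q) L) (λ a → bit (allMasked (atLeast μ) N a) * (2 + toℕ μ) ^ n))
      ≡⟨ cong (q ^ n *_) (∑-cong (allFin q) (λ μ → ∑-*ʳ ((2 + toℕ μ) ^ n) (tuples (allFin q) L) _)) ⟩
    q ^ n * ∑ (allFin q) (λ μ → count μ * (2 + toℕ μ) ^ n)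
      ≡⟨ ∑-*ˡ (q ^ n) (allFin q) _ ⟨
    ∑ (allFin q) (λ μ → q ^ n * (count μ * (2 + toℕ μ) ^ n))
      ≤⟨ ∑-mono (allFin q) term ⟩
    ∑ (allFin q) (const (q ^ L * c² q ^ n))
      ≡⟨ trans (∑-const (allFin q) _) (cong (_* (q ^ L * c² q ^ n)) (length-allFin q)) ⟩
    q * (q ^ L * c² q ^ n)
      ≡⟨ swap q (q ^ L) (c² q ^ n) ⟩
    q ^ L * (q * c² q ^ n) ∎
    where
    open ≤-Reasoning
    n = trues N L
    count : Fin q → ℕ
    count μ = ∑ (tuples (allFin q) L) (bit ∘ allMasked (atLeast μ) N)
    swap : ∀ a b c → a * (b * c) ≡ b * (a * c)
    swap = solve-∀
    term : ∀ μ → q ^ n * (count μ * (2 + toℕ μ) ^ n) ≤ q ^ L * c² q ^ n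
    term μ = begin
      q ^ n * (count μ * (2 + toℕ μ) ^ n)   ≡⟨ *-assoc (q ^ n) (count μ) _ ⟨
      q ^ n * count μ * (2 + toℕ μ) ^ n     ≡⟨ cong (_* (2 + toℕ μ) ^ n) (subst (λ k → k ^ n * count μ ≡ k ^ L * m ^ n) (length-allFin q) (count-allMasked (allFin q) (atLeast μ) N L)) ⟩
      q ^ L * m ^ n * (2 + toℕ μ) ^ n       ≡⟨ *-assoc (q ^ L) _ _ ⟩
      q ^ L * (m ^ n * (2 + toℕ μ) ^ n)     ≡⟨ cong (q ^ L *_) (^-distrib-* m (2 + toℕ μ) n) ⟨
      q ^ L * (m * (2 + toℕ μ)) ^ n         ≤⟨ *-monoʳ-≤ (q ^ L) (^-monoˡ-≤ n (*-monoˡ-≤ (2 + toℕ μ) (count-≥ q (toℕ μ)))) ⟩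
      q ^ L * ((q ∸ toℕ μ) * (2 + toℕ μ)) ^ n ≤⟨ *-monoʳ-≤ (q ^ L) (^-monoˡ-≤ n (uv≤c² q (q ∸ toℕ μ) (2 + toℕ μ) total)) ⟩
      q ^ L * c² q ^ n                      ∎
      where
      m = ∑ (allFin q) (bit ∘ atLeast μ)
      total : q ∸ toℕ μ + (2 + toℕ μ) ≡ q + 2
      total = trans (rearrange (q ∸ toℕ μ) (toℕ μ)) (cong (_+ 2) (m∸n+n≡m (<⇒≤ (toℕ<n μ))))
        where
        rearrange : ∀ r μ → r + (2 + μ) ≡ r + μ + 2
        rearrange = solve-∀

-- Degrees in the bipartite graph between B and A.

∏-mono-All : ∀ {xs : List A} {f g : A → ℕ} → All (λ x → f x ≤ g x) xs → ∏ xs f ≤ ∏ xs g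
∏-mono-All []         = ≤-refl
∏-mono-All (px ∷ pxs) = *-mono-≤ px (∏-mono-All pxs)

∏-^ : ∀ (xs : List A) (f : A → ℕ) n → ∏ xs f ^ n ≡ ∏ xs (λ x → f x ^ n)
∏-^ []       f n = ^-zeroˡ n
∏-^ (x ∷ xs) f n = trans (^-distrib-* (f x) (∏ xs f) n) (cong (f x ^ n *_) (∏-^ xs f n))

∏-≤-^ : ∀ {xs : List A} {f : A → ℕ} m c → All (λ x → m * f x ≤ c) xs → m ^ length xs * ∏ xs f ≤ c ^ length xs
∏-≤-^ m c []                               = ≤-refl
∏-≤-^ {xs = x ∷ xs} {f} m c (px ∷ pxs) = begin
  m * m ^ length xs * (f x * ∏ xs f)       ≡⟨ regroup m (m ^ length xs) (f x) (∏ xs f) ⟩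
  m * f x * (m ^ length xs * ∏ xs f)       ≤⟨ *-mono-≤ px (∏-≤-^ m c pxs) ⟩
  c * c ^ length xs                        ∎
  where
  open ≤-Reasoning
  regroup : ∀ a b c d → a * b * (c * d) ≡ a * c * (b * d)
  regroup = solve-∀

shift : (ℕ → Bool) → ℕ → Bool
shift N zero    = false
shift N (suc y) = N y

shifts : ℕ → (ℕ → Bool) → ℕ → Bool
shifts zero    N = N
shifts (suc k) N = shift (shifts k N)

-- The neighbourhoods in A of the letters of B, in order. As x + y is fixed, a later letter of B has
-- a neighbourhood further to the left, so the shifts decrease from k - 1 to 0.
masks : ℕ → (ℕ → Bool) → List (ℕ → Bool)
masks zero    N = []
masks (suc k) N = shifts k N ∷ masks k N

length-masks : ∀ k N → length (masks k N) ≡ k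
length-masks zero    N = refl
length-masks (suc k) N = cong suc (length-masks k N)

trues-suc : ∀ N y → trues N (suc y) ≡ bit (N y) + trues N y
trues-suc N zero    = refl
trues-suc N (suc y) = trans (cong (bit (N 0) +_) (trues-suc (N ∘ suc) y)) (swap (bit (N 0)) (bit (N (suc y))) _)
  where
  swap : ∀ a b c → a + (b + c) ≡ b + (a + c)
  swap = solve-∀

trues-+ : ∀ N L r → trues N L ≤ trues N (r + L)
trues-+ N L zero    = ≤-refl
trues-+ N L (suc r) = ≤-trans (trues-+ N L r) (≤-trans (m≤n+m _ (bit (N (r + L)))) (≤-reflexive (sym (trues-suc N (r + L)))))

trues-shifts : ∀ k N r → trues (shifts k N) (k + r) ≡ trues N r
trues-shifts zero    N r = refl
trues-shifts (suc k) N r = trues-shifts k N r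

-- At y the k masks read N at y, y - 1, ..., y - k + 1, each place once, and the shifted mask counts
-- the places below. So the degree of a letter of A is at most the number of elements of S.
degree-masks : ∀ k N y → ∑ (masks k N) (λ M → bit (M y)) + trues (shifts k N) (suc y) ≡ trues N (suc y)
degree-masks zero    N y = refl
degree-masks (suc k) N y = begin
  bit (M y) + D + trues M y      ≡⟨ swap (bit (M y)) D (trues M y) ⟩
  D + (bit (M y) + trues M y)    ≡⟨ cong (D +_) (trues-suc M y) ⟨
  D + trues M (suc y)            ≡⟨ degree-masks k N y ⟩
  trues N (suc y)                ∎
  where
  open ≡-Reasoning
  M = shifts k N
  D = ∑ (masks k N) (λ M → bit (M y))
  swap : ∀ a b c → a + b + c ≡ b + (a + c)
  swap = solve-∀

-- All n elements lie below t, and a shift by less than k keeps them below k + t: no neighbourhood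
-- is cut off at the end of A. In the induction k falls while r rises, so the range k + r stays the
-- same.
trues-masks : ∀ {N n t} → (∀ r → t ≤ r → trues N r ≡ n) →
  ∀ k r → t ≤ r → All (λ M → trues M (k + r) ≡ n) (masks k N)
trues-masks N-n zero    r t≤r = []
trues-masks {N} {n} N-n (suc k) r t≤r = subst (λ L → All (λ M → trues M L ≡ n) (masks (suc k) N)) (+-suc k r)
  (trans (trues-shifts k N (suc r)) (N-n (suc r) t≤1+r) ∷ trues-masks N-n k (suc r) t≤1+r)
  where t≤1+r = ≤-trans t≤r (n≤1+n r)

-- The number of compatible fillings of A and B.

module _ (q : ℕ) where

  compatible : ∀ {k L} → (ℕ → Bool) → Vec (Fin q) k → Vec (Fin q) L → Bool
  compatible         N []       a = true
  compatible {suc k} N (b ∷ bs) a = allMasked (heavy q b) (shifts k N) a ∧ compatible N bs a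

  -- For fixed A the letters of B are constrained independently of one another.
  ∑-compatible : ∀ k {L} N (a : Vec (Fin q) L) →
    ∑ (tuples (allFin q) k) (λ bs → bit (compatible N bs a)) ≡ ∏ (masks k N) (λ M → choices q M a)
  ∑-compatible zero    N a = refl
  ∑-compatible (suc k) N a = begin
    ∑ (tuples (allFin q) (suc k)) (λ bs → bit (compatible N bs a))
      ≡⟨ ∑-tuples-suc (allFin q) k _ ⟩
    ∑ (allFin q) (λ b → ∑ (tuples (allFin q) k) (λ bs → bit (first b ∧ compatible N bs a)))
      ≡⟨ ∑-cong (allFin q) (λ b → trans (∑-cong (tuples (allFin q) k) (λ bs → bit-∧ (first b) (compatible N bs a)))
                                      (∑-*ˡ (bit (first b)) (tuples (allFin q) k) (λ bs → bit (compatible N bs a)))) ⟩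
    ∑ (allFin q) (λ b → bit (first b) * R)
      ≡⟨ ∑-*ʳ R (allFin q) (bit ∘ first) ⟩
    choices q (shifts k N) a * R
      ≡⟨ cong (choices q (shifts k N) a *_) (∑-compatible k N a) ⟩
    choices q (shifts k N) a * ∏ (masks k N) (λ M → choices q M a) ∎
    where
    open ≡-Reasoning
    first : Fin q → Bool
    first b = allMasked (heavy q b) (shifts k N) a
    R = ∑ (tuples (allFin q) k) (λ bs → bit (compatible N bs a))

  compatiblePairs : ℕ → ℕ → (ℕ → Bool) → ℕ
  compatiblePairs k L N = ∑ (tuples (allFin q) k) (λ bs → ∑ (tuples (allFin q) L) (λ a → bit (compatible N bs a)))

  -- Each of the k masks has n elements, so with exponent 1/n they account for k letters of A.
  -- Together with B these give C^k and the factor q^(k/n) from the majorants; the t surplus letters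
  -- of A are paid for by q^t.
  compatiblePairs-bound : .{{_ : NonZero q}} → ∀ k t n .{{_ : NonZero n}} N → (∀ r → t ≤ r → trues N r ≡ n) →
    compatiblePairs k (k + t) N ^ n ≤ q ^ (t * n) * (q ^ k * (c² q ^ n) ^ k)
  compatiblePairs-bound k t n N N-n = *-cancelˡ-≤ ((q ^ n) ^ k) {{m^n≢0 (q ^ n) k {{m^n≢0 q n}}}} (*-cancelˡ-≤ (q ^ (k * L)) {{m^n≢0 q (k * L)}} (begin
    q ^ (k * L) * ((q ^ n) ^ k * P ^ n)                               ≡⟨ swap (q ^ (k * L)) ((q ^ n) ^ k) (P ^ n) ⟩
    (q ^ n) ^ k * (q ^ (k * L) * P ^ n)                               ≤⟨ *-monoʳ-≤ ((q ^ n) ^ k) finner-bound ⟩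
    (q ^ n) ^ k * (q ^ (L * n) * ∏ Ms (λ M → ∑ as (majorant q n M)))  ≡⟨ swap ((q ^ n) ^ k) (q ^ (L * n)) _ ⟩
    q ^ (L * n) * ((q ^ n) ^ k * ∏ Ms (λ M → ∑ as (majorant q n M)))
      ≤⟨ *-monoʳ-≤ (q ^ (L * n)) (subst (λ j → (q ^ n) ^ j * ∏ Ms (λ M → ∑ as (majorant q n M)) ≤ (q ^ L * (q * c² q ^ n)) ^ j) len
           (∏-≤-^ (q ^ n) (q ^ L * (q * c² q ^ n)) (All.map (λ { {M} refl → ∑-majorant q L M }) Ms-n))) ⟩
    q ^ (L * n) * (q ^ L * (q * c² q ^ n)) ^ k                         ≡⟨ cong₂ _*_ qLn ∏ᵏ ⟩
    (q ^ n) ^ k * q ^ (t * n) * (q ^ (k * L) * (q ^ k * (c² q ^ n) ^ k))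
      ≡⟨ regroup ((q ^ n) ^ k) (q ^ (t * n)) (q ^ (k * L)) _ ⟩
    q ^ (k * L) * ((q ^ n) ^ k * (q ^ (t * n) * (q ^ k * (c² q ^ n) ^ k))) ∎))
    where
    open ≤-Reasoning
    L = k + t
    Ms = masks k N
    as = tuples (allFin q) L
    P = compatiblePairs k L N
    len = length-masks k N
    x₀ : ∀ {q} .{{_ : NonZero q}} → Fin q
    x₀ {suc _} = zero
    Ms-n : All (λ M → trues M L ≡ n) Ms
    Ms-n = trues-masks N-n k t ≤-refl
    F : Vec (Fin q) L → ℕ
    F a = ∏ Ms (λ M → choices q M a)
    F^n≤ : ∀ a → F a ^ n ≤ ∏ Ms (λ M → majorant q n M a)
    F^n≤ a = ≤-trans (≤-reflexive (∏-^ Ms (λ M → choices q M a) n))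
      (∏-mono-All (All.map (λ {M} τ≡n → choices^n≤majorant q n M a {{subst NonZero (sym τ≡n) it}}) Ms-n))
    degree : ∀ y → ∑ Ms (λ M → bit (M y)) ≤ n
    degree y = ≤-trans (m+n≤o⇒m≤o _ (≤-reflexive (degree-masks k N y)))
      (subst (trues N (suc y) ≤_) (N-n (t + suc y) (m≤m+n t (suc y))) (trues-+ N (suc y) t))
    P≡ : P ≡ ∑ as F
    P≡ = trans (∑-swap (tuples (allFin q) k) as _) (∑-cong as (∑-compatible k N))
    finner-bound : q ^ (k * L) * P ^ n ≤ q ^ (L * n) * ∏ Ms (λ M → ∑ as (majorant q n M))
    finner-bound rewrite P≡ =
      subst₂ (λ p j → p ^ (j * L) * ∑ as F ^ n ≤ p ^ (L * n) * ∏ Ms (λ M → ∑ as (majorant q n M))) (length-allFin q) len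
        (finner x₀ (allFin q) n Ms L id (majorant q n) F (majorant-dependsOnlyOn q n) degree F^n≤)
    qLn : q ^ (L * n) ≡ (q ^ n) ^ k * q ^ (t * n)
    qLn = trans (cong (q ^_) (*-distribʳ-+ n k t)) (trans (^-distribˡ-+-* q (k * n) (t * n))
      (cong (_* q ^ (t * n)) (trans (cong (q ^_) (*-comm k n)) (sym (^-*-assoc q n k)))))
    ∏ᵏ : (q ^ L * (q * c² q ^ n)) ^ k ≡ q ^ (k * L) * (q ^ k * (c² q ^ n) ^ k)
    ∏ᵏ = trans (^-distrib-* (q ^ L) _ k)
      (cong₂ _*_ (trans (^-*-assoc q L k) (cong (q ^_) (*-comm L k))) (^-distrib-* q (c² q ^ n) k))
    swap : ∀ a b c → a * (b * c) ≡ b * (a * c)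
    swap = solve-∀
    regroup : ∀ a b c d → a * b * (c * d) ≡ c * (a * (b * d))
    regroup = solve-∀

-- Words as tuples, and subsets of the tail as Boolean vectors.

∑-tuples-++ : ∀ (xs : List X) m n (f : Vec X (m + n) → ℕ) →
  ∑ (tuples xs (m + n)) f ≡ ∑ (tuples xs m) (λ u → ∑ (tuples xs n) (λ v → f (u ++ v)))
∑-tuples-++ xs zero    n f = sym (+-identityʳ _)
∑-tuples-++ xs (suc m) n f =
  trans (∑-tuples-suc xs (m + n) f)
  (trans (∑-cong xs (λ x → ∑-tuples-++ xs m n (λ w → f (x ∷ w))))
         (sym (∑-tuples-suc xs m _)))

length-tuples : ∀ (xs : List X) n → ∑ (tuples xs n) (const 1) ≡ length xs ^ n
length-tuples xs zero    = refl
length-tuples xs (suc n) =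
  trans (∑-tuples-suc xs n (const 1)) (trans (∑-cong xs (λ _ → length-tuples xs n)) (∑-const xs _))

∑-tuples-const : ∀ (xs : List X) n k → ∑ (tuples xs n) (const k) ≡ length xs ^ n * k
∑-tuples-const xs n k =
  trans (∑-cong (tuples xs n) (λ _ → sym (+-identityʳ k)))
  (trans (∑-*ʳ k (tuples xs n) (const 1)) (cong (_* k) (length-tuples xs n)))

tuples-complete : ∀ {xs : List X} → (∀ x → x ∈ˡ xs) → ∀ {n} (v : Vec X n) → v ∈ˡ tuples xs n
tuples-complete all []      = here refl
tuples-complete all (x ∷ v) = ∈-cartesianProductWith⁺ _∷_ (all x) (tuples-complete all v)

words≡tuples : ∀ q ℓ → words q ℓ ≡ tuples (allFin q) ℓ
words≡tuples q zero    = refl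
words≡tuples q (suc ℓ) rewrite words≡tuples q ℓ = refl

length-filter : ∀ {P : A → Set} (P? : Decidable P) xs → length (filter P? xs) ≡ ∑ xs (λ x → bit (does (P? x)))
length-filter P? []       = refl
length-filter P? (x ∷ xs) with does (P? x)
... | true  = cong suc (length-filter P? xs)
... | false = length-filter P? xs

numTailHeavy≡ : ∀ q ℓ t → numTailHeavy q ℓ t ≡ ∑ (tuples (allFin q) ℓ) (λ w → bit (does (tailHeavy? t w)))
numTailHeavy≡ q ℓ t rewrite sym (words≡tuples q ℓ) = length-filter (tailHeavy? t) (words q ℓ)

numTailHeavy≤q^ℓ : ∀ q ℓ t → numTailHeavy q ℓ t ≤ q ^ ℓ
numTailHeavy≤q^ℓ q ℓ t = begin
  numTailHeavy q ℓ t                                               ≡⟨ numTailHeavy≡ q ℓ t ⟩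
  ∑ (tuples (allFin q) ℓ) (λ w → bit (does (tailHeavy? t w)))      ≤⟨ ∑-mono (tuples (allFin q) ℓ) (λ w → bit-mono {b = true} _) ⟩
  ∑ (tuples (allFin q) ℓ) (const 1)                                ≡⟨ length-tuples (allFin q) ℓ ⟩
  length (allFin q) ^ ℓ                                            ≡⟨ cong (_^ ℓ) (length-allFin q) ⟩
  q ^ ℓ                                                            ∎
  where open ≤-Reasoning

bools : List Bool
bools = false ∷ true ∷ []

bools-complete : ∀ b → b ∈ˡ bools
bools-complete false = here refl
bools-complete true  = there (here refl)

maximiser : ∀ t (f : Vec Bool t → ℕ) → ∃ λ σ* → ∀ σ → f σ ≤ f σ*
maximiser zero    f = [] , λ { [] → ≤-refl }
maximiser (suc t) f with maximiser t (f ∘ (false ∷_)) | maximiser t (f ∘ (true ∷_))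
... | σ₀ , max₀ | σ₁ , max₁ with ≤-total (f (false ∷ σ₀)) (f (true ∷ σ₁))
...   | inj₁ 0≤1 = true ∷ σ₁ , λ { (false ∷ σ) → ≤-trans (max₀ σ) 0≤1 ; (true ∷ σ) → max₁ σ }
...   | inj₂ 1≤0 = false ∷ σ₀ , λ { (false ∷ σ) → max₀ σ ; (true ∷ σ) → ≤-trans (max₁ σ) 1≤0 }

-- The default `false` lets the mask be counted over any range r ≥ t with the same result.
at : ∀ {t} → Vec Bool t → ℕ → Bool
at []      _       = false
at (s ∷ σ) zero    = s
at (s ∷ σ) (suc i) = at σ i

at⁻ : ∀ {t} (σ : Vec Bool t) s → T (at σ s) → ∃ λ i → toℕ i ≡ s × i ∈ σ
at⁻ (true ∷ σ) zero    _  = zero , refl , here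
at⁻ (s ∷ σ)    (suc i) σi = let j , j≡i , j∈σ = at⁻ σ i σi in suc j , cong suc j≡i , there j∈σ

size≡trues : ∀ {t} (σ : Subset t) r → t ≤ r → ∣ σ ∣ ≡ trues (at σ) r
size≡trues []          zero    _         = refl
size≡trues []          (suc r) _         = size≡trues [] r z≤n
size≡trues (true ∷ σ)  (suc r) (s≤s t≤r) = cong suc (size≡trues σ r t≤r)
size≡trues (false ∷ σ) (suc r) (s≤s t≤r) = size≡trues σ r t≤r

shifts⁻ : ∀ k N y → T (shifts k N y) → ∃ λ s → y ≡ k + s × T (N s)
shifts⁻ zero    N y       Ny = y , refl , Ny
shifts⁻ (suc k) N (suc y) Ny = let s , y≡k+s , Ns = shifts⁻ k N y Ny in s , cong suc y≡k+s , Ns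

-- Cutting a word into blocks.

-- `r` keeps the emptiness that the removal of later blocks still needs.
drop-empty : ∀ m r {n} (S : Subset (m + n)) → (∀ i → toℕ i < m + r → i ∉ S) →
  ∃ λ v → ∣ S ∣ ≡ ∣ v ∣ × (∀ i → i ∈ v → m ↑ʳ i ∈ S) × (∀ i → toℕ i < r → i ∉ v)
drop-empty zero    r S           empty = S , refl , (λ _ i∈S → i∈S) , empty
drop-empty (suc m) r (true ∷ S)  empty = contradiction here (empty zero z<s)
drop-empty (suc m) r (false ∷ S) empty =
  let v , ∣S∣≡ , v⊆S , v-empty = drop-empty m r S (λ i i<m i∈S → empty (suc i) (s<s i<m) (there i∈S))
  in v , ∣S∣≡ , (λ i i∈v → there (v⊆S i i∈v)) , v-empty

-- A word of length ℓ ≥ 3t is cut into blocks F B G A Z of lengths t, k, ε, k + t, t.  For i in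
-- the last block Z, the involution x ↦ i − x maps B into A: the letter j of B is paired with the
-- letter (k − 1 − j) + s of A, where s is the index of i within Z.
module Blocks (t k ε : ℕ) where

  -- F pushes B beyond position t, so that i - x < ℓ - t even for i = ℓ and both partners lie
  -- outside the tail, as the heaviness condition demands. G takes up the parity of ℓ - 3t.
  ℓ : ℕ
  ℓ = t + (k + (ε + (k + t + t)))

  inB : Fin k → Fin ℓ
  inB j = t ↑ʳ (j ↑ˡ (ε + (k + t + t)))

  afterG : Fin (k + t + t) → Fin ℓ
  afterG i = t ↑ʳ (k ↑ʳ (ε ↑ʳ i))

  inA : Fin (k + t) → Fin ℓ
  inA y = afterG (y ↑ˡ t)

  inZ : Fin t → Fin ℓ
  inZ i = afterG ((k + t) ↑ʳ i)

  toℕ-inB : ∀ j → toℕ (inB j) ≡ t + toℕ j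
  toℕ-inB j = trans (toℕ-↑ʳ t (j ↑ˡ (ε + (k + t + t)))) (cong (t +_) (toℕ-↑ˡ j (ε + (k + t + t))))

  toℕ-afterG : ∀ i → toℕ (afterG i) ≡ t + (k + (ε + toℕ i))
  toℕ-afterG i =
    trans (toℕ-↑ʳ t (k ↑ʳ (ε ↑ʳ i))) (cong (t +_) (trans (toℕ-↑ʳ k (ε ↑ʳ i)) (cong (k +_) (toℕ-↑ʳ ε i))))

  toℕ-inA : ∀ y → toℕ (inA y) ≡ t + (k + (ε + toℕ y))
  toℕ-inA y = trans (toℕ-afterG (y ↑ˡ t)) (cong (λ p → t + (k + (ε + p))) (toℕ-↑ˡ y t))

  toℕ-inZ : ∀ i → toℕ (inZ i) ≡ t + (k + (ε + (k + t + toℕ i)))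
  toℕ-inZ i = trans (toℕ-afterG ((k + t) ↑ʳ i)) (cong (λ p → t + (k + (ε + p))) (toℕ-↑ʳ (k + t) i))

  prefix-length : t + (k + (ε + (k + t))) + t ≡ ℓ
  prefix-length = assoc t k ε
    where
    assoc : ∀ t k ε → t + (k + (ε + (k + t))) + t ≡ t + (k + (ε + (k + t + t)))
    assoc = solve-∀

  prefix⇒≤ : ∀ {p} → p < t + (k + (ε + (k + t))) → suc p + t ≤ ℓ
  prefix⇒≤ p< = ≤-trans (+-monoˡ-≤ t p<) (≤-reflexive prefix-length)

  inB-prefix : ∀ j → position (inB j) + t ≤ ℓ
  inB-prefix j = prefix⇒≤ (subst (_< t + (k + (ε + (k + t)))) (sym (toℕ-inB j))
    (+-monoʳ-< t (<-≤-trans (toℕ<n j) (m≤m+n k (ε + (k + t))))))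

  inA-prefix : ∀ y → position (inA y) + t ≤ ℓ
  inA-prefix y = prefix⇒≤ (subst (_< t + (k + (ε + (k + t)))) (sym (toℕ-inA y))
    (+-monoʳ-< t (+-monoʳ-< k (+-monoʳ-< ε (toℕ<n y)))))

  positions : ∀ j y i → toℕ y + suc (toℕ j) ≡ k + toℕ i → position (inB j) + position (inA y) ≡ position (inZ i)
  positions j y i eq = begin
    suc (toℕ (inB j)) + suc (toℕ (inA y))                   ≡⟨ cong₂ (λ b a → suc b + suc a) (toℕ-inB j) (toℕ-inA y) ⟩
    suc (t + toℕ j) + suc (t + (k + (ε + toℕ y)))           ≡⟨ regroup t k ε (toℕ j) (toℕ y) ⟩
    suc (t + k + ε + t + (toℕ y + suc (toℕ j)))             ≡⟨ cong (λ p → suc (t + k + ε + t + p)) eq ⟩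
    suc (t + k + ε + t + (k + toℕ i))                       ≡⟨ cong suc (collect t k ε (toℕ i)) ⟩
    suc (t + (k + (ε + (k + t + toℕ i))))                   ≡⟨ cong suc (toℕ-inZ i) ⟨
    suc (toℕ (inZ i))                                       ∎
    where
    open ≡-Reasoning
    regroup : ∀ t k ε j y → suc (t + j) + suc (t + (k + (ε + y))) ≡ suc (t + k + ε + t + (y + suc j))
    regroup = solve-∀
    collect : ∀ t k ε i → t + k + ε + t + (k + i) ≡ t + (k + (ε + (k + t + i)))
    collect = solve-∀

  tail-mask : ∀ (S : Subset ℓ) → (∀ i → i ∈ S → ℓ < position i + t) →
    ∃ λ (σ : Subset t) → ∣ S ∣ ≡ ∣ σ ∣ × (∀ i → i ∈ σ → inZ i ∈ S)
  tail-mask S S-tail =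
    let S₁ , ∣S∣≡  , S₁⊆ , S₁-empty = drop-empty t (k + (ε + (k + t))) S (λ i i< i∈S → <⇒≱ (S-tail i i∈S) (prefix⇒≤ i<))
        S₂ , ∣S₁∣≡ , S₂⊆ , S₂-empty = drop-empty k (ε + (k + t)) S₁ S₁-empty
        S₃ , ∣S₂∣≡ , S₃⊆ , S₃-empty = drop-empty ε (k + t) S₂ S₂-empty
        σ  , ∣S₃∣≡ , σ⊆  , _        = drop-empty (k + t) 0 S₃ (λ i i< → S₃-empty i (subst (toℕ i <_) (+-identityʳ (k + t)) i<))
    in σ , trans ∣S∣≡ (trans ∣S₁∣≡ (trans ∣S₂∣≡ ∣S₃∣≡)) ,
       λ i i∈σ → S₁⊆ _ (S₂⊆ _ (S₃⊆ _ (σ⊆ i i∈σ)))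

-- From tail-heavy words to compatible fillings.

module _ (q : ℕ) where

  top : Fin q → Bool
  top x = suc (toℕ x) ≡ᵇ q

  compatible⁺ : ∀ {k L} N (B : Vec (Fin q) k) (A : Vec (Fin q) L) →
    (∀ j y s → toℕ y + suc (toℕ j) ≡ k + s → T (N s) → T (heavy q (lookup B j) (lookup A y))) →
    T (compatible q N B A)
  compatible⁺         N []      A ok = tt
  compatible⁺ {suc k} N (b ∷ B) A ok = Equivalence.from T-∧
    ( allMasked⁺ (heavy q b) (shifts k N) A
        (λ y Ny → let s , y≡k+s , Ns = shifts⁻ k N (toℕ y) Ny
                  in ok zero y s (trans (+-comm (toℕ y) 1) (cong suc y≡k+s)) Ns)
    , compatible⁺ N B A (λ j y s eq → ok (suc j) y s (trans (+-suc (toℕ y) (suc (toℕ j))) (cong suc eq))) )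

  module _ (t k ε : ℕ) (F : Word q t) (B : Word q k) (G : Word q ε) (A : Word q (k + t)) (Z : Word q t) where

    open Blocks t k ε

    private
      word : Word q ℓ
      word = F ++ (B ++ (G ++ (A ++ Z)))

    lookup-inB : ∀ j → lookup word (inB j) ≡ lookup B j
    lookup-inB j = trans (lookup-++ʳ F (B ++ (G ++ (A ++ Z))) (j ↑ˡ (ε + (k + t + t)))) (lookup-++ˡ B (G ++ (A ++ Z)) j)

    lookup-afterG : ∀ i → lookup word (afterG i) ≡ lookup (A ++ Z) i
    lookup-afterG i = trans (lookup-++ʳ F (B ++ (G ++ (A ++ Z))) (k ↑ʳ (ε ↑ʳ i)))
      (trans (lookup-++ʳ B (G ++ (A ++ Z)) (ε ↑ʳ i)) (lookup-++ʳ G (A ++ Z) i))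

    lookup-inA : ∀ y → lookup word (inA y) ≡ lookup A y
    lookup-inA y = trans (lookup-afterG (y ↑ˡ t)) (lookup-++ˡ A Z y)

    lookup-inZ : ∀ i → lookup word (inZ i) ≡ lookup Z i
    lookup-inZ i = trans (lookup-afterG ((k + t) ↑ʳ i)) (lookup-++ʳ A Z i)

    tailHeavy⇒mask : TailHeavy t word →
      ∃ λ σ → T (ℓ <ᵇ ∣ σ ∣ * ∣ σ ∣) × T (compatible q (at σ) B A) × T (allMasked top (at σ) Z)
    tailHeavy⇒mask (S , ℓ<∣S∣² , S-top , S-heavy) =
      let σ , ∣S∣≡∣σ∣ , σ⊆ = tail-mask S (λ i i∈S → proj₁ (S-top i i∈S))
      in σ , <⇒<ᵇ (subst (λ n → ℓ < n * n) ∣S∣≡∣σ∣ ℓ<∣S∣²)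
           , compatible⁺ (at σ) B A (λ j y s eq σs →
               let i , i≡s , i∈σ = at⁻ σ s σs
               in ≤⇒≤ᵇ (subst₂ (λ b a → q ≤ suc (toℕ b) + suc (toℕ a)) (lookup-inB j) (lookup-inA y)
                    (S-heavy (inB j) (inA y) (inZ i) (inB-prefix j) (inA-prefix y) (σ⊆ i i∈σ)
                      (positions j y i (trans eq (cong (k +_) (sym i≡s)))))))
           , allMasked⁺ top (at σ) Z (λ y σy →
               let i , i≡y , i∈σ = at⁻ σ (toℕ y) σy
               in ≡⇒≡ᵇ (suc (toℕ (lookup Z y))) q
                    (trans (cong (suc ∘ toℕ) (trans (cong (lookup Z) (sym (toℕ-injective i≡y))) (sym (lookup-inZ i))))
                           (proj₂ (S-top (inZ i) (σ⊆ i i∈σ)))))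

-- Summing over the tails and over S.

∑-factor : ∀ (xs : List X) (ys : List Y) (u : Y → ℕ) (f : Y → X → ℕ) →
  ∑ xs (λ x → ∑ ys (λ y → u y * f y x)) ≡ ∑ ys (λ y → u y * ∑ xs (f y))
∑-factor xs ys u f = trans (∑-swap xs ys (λ x y → u y * f y x)) (∑-cong ys (λ y → ∑-*ˡ (u y) xs (f y)))

module _ (q : ℕ) where

  count-top≤1 : ∑ (allFin q) (bit ∘ top q) ≤ 1
  count-top≤1 = begin
    ∑ (allFin q) (bit ∘ top q)                      ≤⟨ ∑-mono (allFin q) (λ x → bit-mono (λ top-x →
                                                      ≤⇒≤ᵇ (≤-reflexive (cong pred (sym (≡ᵇ⇒≡ (suc (toℕ x)) q top-x)))))) ⟩
    ∑ (allFin q) (λ x → bit (pred q ≤ᵇ toℕ x))      ≤⟨ count-≥ q (pred q) ⟩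
    q ∸ pred q                                   ≤⟨ m≤n+o⇒m∸n≤o q (pred q) (≤-trans (q≤1+pred q) (≤-reflexive (+-comm 1 (pred q)))) ⟩
    1                                            ∎
    where
    open ≤-Reasoning
    q≤1+pred : ∀ q → q ≤ suc (pred q)
    q≤1+pred zero    = z≤n
    q≤1+pred (suc q) = ≤-refl

  tailWords : ∀ {t} → Vec Bool t → ℕ
  tailWords {t} σ = ∑ (tuples (allFin q) t) (λ Z → bit (allMasked (top q) (at σ) Z))

  -- A tail position either lies outside S and carries any of q letters, or lies in S and carries
  -- the letter q: at most q + 1 cases.
  ∑-tailWords : ∀ t → ∑ (tuples bools t) tailWords ≤ suc q ^ t
  ∑-tailWords zero    = ≤-refl
  ∑-tailWords (suc t) = begin
    ∑ (tuples bools (suc t)) tailWords                              ≡⟨ ∑-tuples-suc bools t tailWords ⟩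
    ∑ bools (λ s → ∑ (tuples bools t) (λ σ → tailWords (s ∷ σ)))    ≡⟨ ∑-cong bools (λ s → trans (∑-cong (tuples bools t) (split s)) (∑-*ˡ (heads s) (tuples bools t) tailWords)) ⟩
    ∑ bools (λ s → heads s * R)                                     ≡⟨ ∑-*ʳ R bools heads ⟩
    ∑ bools heads * R                                               ≤⟨ *-mono-≤ heads≤ (∑-tailWords t) ⟩
    suc q * suc q ^ t                                               ∎
    where
    open ≤-Reasoning
    R = ∑ (tuples bools t) tailWords
    heads : Bool → ℕ
    heads s = ∑ (allFin q) (λ x → bit (not s ∨ top q x))
    split : ∀ s σ → tailWords (s ∷ σ) ≡ heads s * tailWords σ
    split s σ = trans (∑-tuples-suc (allFin q) t _)
      (trans (∑-cong (allFin q) (λ x → trans (∑-cong (tuples (allFin q) t) (λ Z → bit-∧ (not s ∨ top q x) (allMasked (top q) (at σ) Z)))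
                                           (∑-*ˡ (bit (not s ∨ top q x)) (tuples (allFin q) t) _)))
             (∑-*ʳ (tailWords σ) (allFin q) (λ x → bit (not s ∨ top q x))))
    heads≤ : ∑ bools heads ≤ suc q
    heads≤ = begin
      heads false + (heads true + 0)                  ≡⟨ cong₂ _+_ (trans (∑-const (allFin q) 1) (trans (*-identityʳ _) (length-allFin q))) (+-identityʳ (heads true)) ⟩
      q + heads true                                  ≤⟨ +-monoʳ-≤ q count-top≤1 ⟩
      q + 1                                           ≡⟨ +-comm q 1 ⟩
      suc q                                           ∎

  module _ (t k ε : ℕ) where

    open Blocks t k ε using (ℓ)

    private
      large : Vec Bool t → Bool
      large σ = ℓ <ᵇ ∣ σ ∣ * ∣ σ ∣
      σs : List (Vec Bool t)
      σs = tuples bools t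

    -- Small sets impose few constraints, the empty set none. The indicator removes them, so that a
    -- nonzero maximum is attained at a set with n² > ℓ.
    weightedPairs : Vec Bool t → ℕ
    weightedPairs σ = bit (large σ) * compatiblePairs q k (k + t) (at σ)

    tailHeavy-indicator : ∀ F B G A Z →
      bit (does (tailHeavy? t (F ++ (B ++ (G ++ (A ++ Z)))))) ≤
        ∑ σs (λ σ → bit (large σ) * bit (compatible q (at σ) B A) * bit (allMasked (top q) (at σ) Z))
    tailHeavy-indicator F B G A Z with tailHeavy? t (F ++ (B ++ (G ++ (A ++ Z))))
    ... | no  _  = z≤n
    ... | yes th =
      let σ , σ-large , σ-compatible , σ-top = tailHeavy⇒mask q t k ε F B G A Z th
      in ≤-trans
        (≤-reflexive (sym (cong₂ _*_ (cong₂ _*_ (bit-T σ-large) (bit-T σ-compatible)) (bit-T σ-top))))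
        (term≤∑ (λ σ → bit (large σ) * bit (compatible q (at σ) B A) * bit (allMasked (top q) (at σ) Z))
          (tuples-complete bools-complete σ))

    -- F and G are free. The rest is a union bound over σ, and for each σ the sums separate, because
    -- compatibility involves only A and B and the top letters only Z.
    numTailHeavy≤ : ∀ K → (∀ σ → weightedPairs σ ≤ K) → numTailHeavy q ℓ t ≤ q ^ t * (q ^ ε * (K * suc q ^ t))
    numTailHeavy≤ K pairs≤K = begin
      numTailHeavy q ℓ t
        ≡⟨ numTailHeavy≡ q ℓ t ⟩
      ∑ (W ℓ) (λ w → bit (does (tailHeavy? t w)))
        ≡⟨ ∑-tuples-++ (allFin q) t _ _ ⟩
      ∑ (W t) (λ F → ∑ (W (k + (ε + (k + t + t)))) (λ w → bit (does (tailHeavy? t (F ++ w)))))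
        ≤⟨ ∑-mono (W t) (λ F → ≤-trans (≤-reflexive (∑-tuples-++ (allFin q) k _ _)) (∑-mono (W k) (λ B →
             ≤-trans (≤-reflexive (∑-tuples-++ (allFin q) ε _ _)) (∑-mono (W ε) (λ G →
             ≤-trans (≤-reflexive (∑-tuples-++ (allFin q) (k + t) t _)) (∑-mono (W (k + t)) (λ A →
             ∑-mono (W t) (λ Z → tailHeavy-indicator F B G A Z)))))))) ⟩
      ∑ (W t) (λ F → ∑ (W k) (λ B → ∑ (W ε) (λ G → ∑ (W (k + t)) (λ A → ∑ (W t) (λ Z → ∑ σs (λ σ →
        bit (large σ) * cmp σ B A * bit (allMasked (top q) (at σ) Z)))))))
        ≡⟨ ∑-cong (W t) (λ F → trans (∑-cong (W k) (λ B → trans (∑-cong (W ε) (λ G → sumAZ B)) (sum-const ε _))) sumB) ⟩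
      ∑ (W t) (λ F → q ^ ε * ∑ σs (λ σ → bit (large σ) * tailWords σ * compatiblePairs q k (k + t) (at σ)))
        ≡⟨ sum-const t _ ⟩
      q ^ t * (q ^ ε * ∑ σs (λ σ → bit (large σ) * tailWords σ * compatiblePairs q k (k + t) (at σ)))
        ≤⟨ *-monoʳ-≤ (q ^ t) (*-monoʳ-≤ (q ^ ε) weighted) ⟩
      q ^ t * (q ^ ε * (K * suc q ^ t)) ∎
      where
      open ≤-Reasoning
      W : ∀ n → List (Vec (Fin q) n)
      W = tuples (allFin q)
      cmp : Vec Bool t → Vec (Fin q) k → Vec (Fin q) (k + t) → ℕ
      cmp σ B A = bit (compatible q (at σ) B A)
      regroup : ∀ a b c → a * b * c ≡ a * c * b
      regroup = solve-∀
      sumAZ : ∀ B → ∑ (W (k + t)) (λ A → ∑ (W t) (λ Z → ∑ σs (λ σ → bit (large σ) * cmp σ B A * bit (allMasked (top q) (at σ) Z))))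
        ≡ ∑ σs (λ σ → bit (large σ) * tailWords σ * ∑ (W (k + t)) (cmp σ B))
      sumAZ B = trans (∑-cong (W (k + t)) (λ A → trans
          (∑-factor (W t) σs (λ σ → bit (large σ) * cmp σ B A) (λ σ Z → bit (allMasked (top q) (at σ) Z)))
          (∑-cong σs (λ σ → regroup (bit (large σ)) (cmp σ B A) (tailWords σ)))))
        (∑-factor (W (k + t)) σs (λ σ → bit (large σ) * tailWords σ) (λ σ → cmp σ B))
      sum-const : ∀ n s → ∑ (W n) (const s) ≡ q ^ n * s
      sum-const n s = trans (∑-tuples-const (allFin q) n s) (cong (λ p → p ^ n * s) (length-allFin q))
      sumB : ∑ (W k) (λ B → q ^ ε * ∑ σs (λ σ → bit (large σ) * tailWords σ * ∑ (W (k + t)) (cmp σ B)))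
        ≡ q ^ ε * ∑ σs (λ σ → bit (large σ) * tailWords σ * compatiblePairs q k (k + t) (at σ))
      sumB = trans (∑-*ˡ (q ^ ε) (W k) _)
        (cong (q ^ ε *_) (∑-factor (W k) σs (λ σ → bit (large σ) * tailWords σ) (λ σ B → ∑ (W (k + t)) (cmp σ B))))
      weighted : ∑ σs (λ σ → bit (large σ) * tailWords σ * compatiblePairs q k (k + t) (at σ)) ≤ K * suc q ^ t
      weighted = begin
        ∑ σs (λ σ → bit (large σ) * tailWords σ * compatiblePairs q k (k + t) (at σ))
          ≤⟨ ∑-mono σs (λ σ → ≤-trans (≤-reflexive (regroup (bit (large σ)) (tailWords σ) _)) (*-monoˡ-≤ (tailWords σ) (pairs≤K σ))) ⟩
        ∑ σs (λ σ → K * tailWords σ)    ≡⟨ ∑-*ˡ K σs tailWords ⟩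
        K * ∑ σs tailWords              ≤⟨ *-monoʳ-≤ K (∑-tailWords t) ⟩
        K * suc q ^ t                   ∎

-- Absorbing all lower-order factors into powers of C.

q≤c² : ∀ q → q ≤ c² q
q≤c² q = ≤-trans (m≤m*n q 2) (uv≤c² q q 2 refl)

c²-nonZero : ∀ q .{{_ : NonZero q}} → NonZero (c² q)
c²-nonZero q = >-nonZero (<-≤-trans (>-nonZero⁻¹ q) (q≤c² q))

-- The floor loses at most 3/4, so 4C ≥ (q + 2)² - 3, which is r² + 10r + 22 at q = r + 3; 64 is 4³.
-- After this loss the inequality fails at q = 1 and q = 2, hence the separate cases. From q = 3 on,
-- the difference is a polynomial in r with positive coefficients.
[q[1+q]]²≤c²³ : ∀ q → (q * suc q) ^ 2 ≤ c² q ^ 3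
[q[1+q]]²≤c²³ 0 = ≤ᵇ⇒≤ _ _ tt
[q[1+q]]²≤c²³ 1 = ≤ᵇ⇒≤ _ _ tt
[q[1+q]]²≤c²³ 2 = ≤ᵇ⇒≤ _ _ tt
[q[1+q]]²≤c²³ q@(suc (suc (suc r))) = *-cancelˡ-≤ 64 (begin
  64 * (q * suc q) ^ 2              ≤⟨ m≤m+n _ _ ⟩
  64 * (q * suc q) ^ 2 + (r * (r * (r * (r * (r * (r + 30) + 302) + 1424) + 3380) + 3768) + 1432)
                                    ≡⟨ polynomial r ⟩
  (r * r + 10 * r + 22) ^ 3         ≤⟨ ^-monoˡ-≤ 3 (+-cancelʳ-≤ 3 _ _ floor) ⟩
  (c² q * 4) ^ 3                    ≡⟨ cube (c² q) ⟩
  64 * c² q ^ 3                     ∎)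
  where
  open ≤-Reasoning
  polynomial : ∀ r → 64 * ((3 + r) * (4 + r) * ((3 + r) * (4 + r) * 1)) + (r * (r * (r * (r * (r * (r + 30) + 302) + 1424) + 3380) + 3768) + 1432)
    ≡ (r * r + 10 * r + 22) * ((r * r + 10 * r + 22) * ((r * r + 10 * r + 22) * 1))
  polynomial = solve-∀
  cube : ∀ c → c * 4 * (c * 4 * (c * 4 * 1)) ≡ 64 * (c * (c * (c * 1)))
  cube = solve-∀
  floor : r * r + 10 * r + 22 + 3 ≤ c² q * 4 + 3
  floor = begin
    r * r + 10 * r + 22 + 3                      ≡⟨ square r ⟩
    (q + 2) * (q + 2)                              ≡⟨ m≡m%n+[m/n]*n ((q + 2) * (q + 2)) 4 ⟩
    (q + 2) * (q + 2) % 4 + c² q * 4               ≤⟨ +-monoˡ-≤ (c² q * 4) (s≤s⁻¹ (m%n<n ((q + 2) * (q + 2)) 4)) ⟩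
    3 + c² q * 4                                   ≡⟨ +-comm 3 (c² q * 4) ⟩
    c² q * 4 + 3                                   ∎
    where
    square : ∀ r → r * r + 10 * r + 22 + 3 ≡ (3 + r + 2) * (3 + r + 2)
    square = solve-∀

-- N ≤ q^t · c_q^(ℓ + ℓ/n + 10) for some n ≥ √ℓ, with roots cleared.
Bounded : ℕ → ℕ → ℕ → ℕ → Set
Bounded q ℓ t N = ∃ λ n → NonZero n × ℓ ≤ n * n × N ^ (n * 2) ≤ q ^ (t * (n * 2)) * c² q ^ (n * (ℓ + 10) + ℓ)

bounded-from-square : ∀ q ℓ t N .{{_ : NonZero q}} → N ^ 2 ≤ q ^ (t * 2) * c² q ^ (ℓ + 10) → Bounded q ℓ t N
bounded-from-square q ℓ t N N²≤ = n , _ , ≤-trans (n≤1+n ℓ) (m≤m*n n n) , (begin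
  N ^ (n * 2)                                            ≡⟨ trans (cong (N ^_) (*-comm n 2)) (sym (^-*-assoc N 2 n)) ⟩
  (N ^ 2) ^ n                                            ≤⟨ ^-monoˡ-≤ n N²≤ ⟩
  (q ^ (t * 2) * C ^ (ℓ + 10)) ^ n                       ≡⟨ ^-distrib-* (q ^ (t * 2)) (C ^ (ℓ + 10)) n ⟩
  (q ^ (t * 2)) ^ n * (C ^ (ℓ + 10)) ^ n                 ≡⟨ cong₂ _*_ (trans (^-*-assoc q (t * 2) n) (cong (q ^_) (swap t n)))
                                                               (trans (^-*-assoc C (ℓ + 10) n) (cong (C ^_) (*-comm (ℓ + 10) n))) ⟩
  q ^ (t * (n * 2)) * C ^ (n * (ℓ + 10))                 ≤⟨ *-monoʳ-≤ (q ^ (t * (n * 2))) (^-monoʳ-≤ C {{c²-nonZero q}} (m≤m+n (n * (ℓ + 10)) ℓ)) ⟩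
  q ^ (t * (n * 2)) * C ^ (n * (ℓ + 10) + ℓ)             ∎)
  where
  open ≤-Reasoning
  -- The hypothesis makes no use of the term ℓ/n, so any nonzero n with n² ≥ ℓ will do.
  n = suc ℓ
  C = c² q
  swap : ∀ t n → t * 2 * n ≡ t * (n * 2)
  swap = solve-∀

-- If ℓ < 3t then already q^ℓ is small enough, because q² ≤ c_q³.
bounded-short : ∀ q ℓ t .{{_ : NonZero q}} → ℓ < 3 * t → Bounded q ℓ t (q ^ ℓ)
bounded-short q ℓ t ℓ<3t with ≤-total ℓ t
... | inj₁ ℓ≤t = bounded-from-square q ℓ t (q ^ ℓ) (begin
  (q ^ ℓ) ^ 2                        ≡⟨ ^-*-assoc q ℓ 2 ⟩
  q ^ (ℓ * 2)                        ≤⟨ ^-monoʳ-≤ q (*-monoˡ-≤ 2 ℓ≤t) ⟩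
  q ^ (t * 2)                        ≤⟨ m≤m*n (q ^ (t * 2)) (c² q ^ (ℓ + 10)) {{m^n≢0 (c² q) (ℓ + 10) {{c²-nonZero q}}}} ⟩
  q ^ (t * 2) * c² q ^ (ℓ + 10)      ∎)
  where
  open ≤-Reasoning
... | inj₂ t≤ℓ = bounded-from-square q ℓ t (q ^ ℓ) (begin
  (q ^ ℓ) ^ 2                                  ≡⟨ ^-*-assoc q ℓ 2 ⟩
  q ^ (ℓ * 2)                                  ≡⟨ cong (q ^_) ℓ2≡ ⟩
  q ^ (t * 2 + (4 * e + δ * 2))                ≡⟨ trans (^-distribˡ-+-* q (t * 2) _) (cong (q ^ (t * 2) *_) (^-distribˡ-+-* q (4 * e) (δ * 2))) ⟩
  q ^ (t * 2) * (q ^ (4 * e) * q ^ (δ * 2))    ≤⟨ *-monoʳ-≤ (q ^ (t * 2)) (*-mono-≤ q⁴ᵉ≤ (^-monoˡ-≤ (δ * 2) (q≤c² q))) ⟩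
  q ^ (t * 2) * (C ^ (3 * e) * C ^ (δ * 2))    ≡⟨ cong (q ^ (t * 2) *_) (^-distribˡ-+-* C (3 * e) (δ * 2)) ⟨
  q ^ (t * 2) * C ^ (3 * e + δ * 2)            ≤⟨ *-monoʳ-≤ (q ^ (t * 2)) (^-monoʳ-≤ C {{c²-nonZero q}} exponent) ⟩
  q ^ (t * 2) * C ^ (ℓ + 10)                   ∎)
  where
  open ≤-Reasoning
  C = c² q
  d = ℓ ∸ t
  e = d / 2
  δ = d % 2
  d≡ : d ≡ δ + e * 2
  d≡ = m≡m%n+[m/n]*n d 2
  ℓ≡ : ℓ ≡ t + (δ + e * 2)
  ℓ≡ = trans (sym (m+[n∸m]≡n t≤ℓ)) (cong (t +_) d≡)
  ℓ2≡ : ℓ * 2 ≡ t * 2 + (4 * e + δ * 2)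
  ℓ2≡ = trans (cong (_* 2) ℓ≡) (expand t δ e)
    where
    expand : ∀ t δ e → (t + (δ + e * 2)) * 2 ≡ t * 2 + (4 * e + δ * 2)
    expand = solve-∀
  e≤t : e ≤ t
  e≤t = *-cancelʳ-≤ e t 2 (+-cancelˡ-≤ t _ _ (begin
    t + e * 2            ≤⟨ +-monoʳ-≤ t (m≤n+m (e * 2) δ) ⟩
    t + (δ + e * 2)      ≡⟨ ℓ≡ ⟨
    ℓ                    ≤⟨ <⇒≤ ℓ<3t ⟩
    3 * t                ≡⟨ three t ⟩
    t + t * 2            ∎))
    where
    three : ∀ t → 3 * t ≡ t + t * 2
    three = solve-∀
  q⁴ᵉ≤ : q ^ (4 * e) ≤ C ^ (3 * e)
  q⁴ᵉ≤ = begin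
    q ^ (4 * e)          ≡⟨ ^-*-assoc q 4 e ⟨
    (q ^ 4) ^ e          ≡⟨ cong (_^ e) (fourth q) ⟩
    ((q * q) ^ 2) ^ e    ≤⟨ ^-monoˡ-≤ e (^-monoˡ-≤ 2 (*-monoʳ-≤ q (n≤1+n q))) ⟩
    ((q * suc q) ^ 2) ^ e ≤⟨ ^-monoˡ-≤ e ([q[1+q]]²≤c²³ q) ⟩
    (C ^ 3) ^ e          ≡⟨ ^-*-assoc C 3 e ⟩
    C ^ (3 * e)          ∎
    where
    fourth : ∀ q → q * (q * (q * (q * 1))) ≡ q * q * (q * q * 1)
    fourth = solve-∀
  exponent : 3 * e + δ * 2 ≤ ℓ + 10
  exponent = begin
    3 * e + δ * 2               ≡⟨ regroup e δ ⟩
    e + (δ + e * 2) + δ         ≤⟨ +-mono-≤ (+-monoˡ-≤ (δ + e * 2) e≤t) (≤-trans (s≤s⁻¹ (m%n<n d 2)) (m≤m+n 1 9)) ⟩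
    t + (δ + e * 2) + 10        ≡⟨ cong (_+ 10) ℓ≡ ⟨
    ℓ + 10                      ∎
    where
    regroup : ∀ e δ → 3 * e + δ * 2 ≡ e + (δ + e * 2) + δ
    regroup = solve-∀

-- Up to parity ℓ = 3t + 2k. The 2k paired letters cost C^k = c_q^(2k). The other 3t are the prefix,
-- the surplus of A and the tail, with costs q^t, q^t and (q + 1)^t; one q^t stays in the bound, and
-- (q (q + 1))^t ≤ c_q^(3t). There remain q^(k/n) ≤ c_q^(2k/n), where 2k ≤ ℓ, and q^ε ≤ c_q², which
-- goes into the 10.
combine-bounds : ∀ q t k ε n N P .{{_ : NonZero q}} → ε ≤ 1 →
  N ≤ q ^ t * (q ^ ε * (P * suc q ^ t)) →
  P ^ n ≤ q ^ (t * n) * (q ^ k * (c² q ^ n) ^ k) →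
  let ℓ = t + (k + (ε + (k + t + t))) in
  N ^ (n * 2) ≤ q ^ (t * (n * 2)) * c² q ^ (n * (ℓ + 10) + ℓ)
combine-bounds q t k ε n N P ε≤1 N≤ Pⁿ≤ = begin
  N ^ m                                                        ≤⟨ ^-monoˡ-≤ m N≤ ⟩
  (q ^ t * (q ^ ε * (P * Q ^ t))) ^ m                          ≡⟨ distribute ⟩
  q ^ (t * m) * (q ^ (ε * m) * (P ^ m * Q ^ (t * m)))          ≤⟨ *-monoʳ-≤ (q ^ (t * m)) (*-mono-≤ q^ε≤ P^m*Q≤) ⟩
  q ^ (t * m) * (C ^ m * (C ^ (3 * (t * n)) * (C ^ (k * 2) * C ^ (n * k * 2))))
    ≡⟨ cong (q ^ (t * m) *_) collectC ⟩
  q ^ (t * m) * C ^ (m + (3 * (t * n) + (k * 2 + n * k * 2)))  ≤⟨ *-monoʳ-≤ (q ^ (t * m)) (^-monoʳ-≤ C {{c²-nonZero q}} exponent) ⟩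
  q ^ (t * m) * C ^ (n * (ℓ + 10) + ℓ)                         ∎
  where
  open ≤-Reasoning
  ℓ = t + (k + (ε + (k + t + t)))
  m = n * 2
  C = c² q
  Q = suc q
  distribute : (q ^ t * (q ^ ε * (P * Q ^ t))) ^ m ≡ q ^ (t * m) * (q ^ (ε * m) * (P ^ m * Q ^ (t * m)))
  distribute = trans (^-distrib-* (q ^ t) _ m) (cong₂ _*_ (^-*-assoc q t m)
    (trans (^-distrib-* (q ^ ε) _ m) (cong₂ _*_ (^-*-assoc q ε m)
    (trans (^-distrib-* P (Q ^ t) m) (cong (P ^ m *_) (^-*-assoc Q t m))))))
  q^ε≤ : q ^ (ε * m) ≤ C ^ m
  q^ε≤ = begin
    q ^ (ε * m)   ≤⟨ ^-monoʳ-≤ q (*-monoˡ-≤ m ε≤1) ⟩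
    q ^ (1 * m)   ≡⟨ cong (q ^_) (*-identityˡ m) ⟩
    q ^ m         ≤⟨ ^-monoˡ-≤ m (q≤c² q) ⟩
    C ^ m         ∎
  P^m≤ : P ^ m ≤ q ^ (t * m) * (C ^ (k * 2) * C ^ (n * k * 2))
  P^m≤ = begin
    P ^ m                                             ≡⟨ ^-*-assoc P n 2 ⟨
    (P ^ n) ^ 2                                       ≤⟨ ^-monoˡ-≤ 2 Pⁿ≤ ⟩
    (q ^ (t * n) * (q ^ k * (C ^ n) ^ k)) ^ 2         ≡⟨ trans (^-distrib-* (q ^ (t * n)) _ 2) (cong₂ _*_ (trans (^-*-assoc q (t * n) 2) (cong (q ^_) (*-assoc t n 2)))
                                                           (trans (^-distrib-* (q ^ k) _ 2) (cong₂ _*_ (^-*-assoc q k 2)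
                                                             (trans (cong (_^ 2) (^-*-assoc C n k)) (^-*-assoc C (n * k) 2))))) ⟩
    q ^ (t * m) * (q ^ (k * 2) * C ^ (n * k * 2))     ≤⟨ *-monoʳ-≤ (q ^ (t * m)) (*-monoˡ-≤ (C ^ (n * k * 2)) (^-monoˡ-≤ (k * 2) (q≤c² q))) ⟩
    q ^ (t * m) * (C ^ (k * 2) * C ^ (n * k * 2))     ∎
  qQ≤ : q ^ (t * m) * Q ^ (t * m) ≤ C ^ (3 * (t * n))
  qQ≤ = begin
    q ^ (t * m) * Q ^ (t * m)      ≡⟨ ^-distrib-* q Q (t * m) ⟨
    (q * Q) ^ (t * m)              ≡⟨ cong ((q * Q) ^_) (swap t n) ⟩
    (q * Q) ^ (2 * (t * n))        ≡⟨ ^-*-assoc (q * Q) 2 (t * n) ⟨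
    ((q * Q) ^ 2) ^ (t * n)        ≤⟨ ^-monoˡ-≤ (t * n) ([q[1+q]]²≤c²³ q) ⟩
    (C ^ 3) ^ (t * n)              ≡⟨ ^-*-assoc C 3 (t * n) ⟩
    C ^ (3 * (t * n))              ∎
    where
    swap : ∀ t n → t * (n * 2) ≡ 2 * (t * n)
    swap = solve-∀
  P^m*Q≤ : P ^ m * Q ^ (t * m) ≤ C ^ (3 * (t * n)) * (C ^ (k * 2) * C ^ (n * k * 2))
  P^m*Q≤ = begin
    P ^ m * Q ^ (t * m)                                             ≤⟨ *-monoˡ-≤ (Q ^ (t * m)) P^m≤ ⟩
    q ^ (t * m) * (C ^ (k * 2) * C ^ (n * k * 2)) * Q ^ (t * m)     ≡⟨ swap (q ^ (t * m)) (C ^ (k * 2) * C ^ (n * k * 2)) (Q ^ (t * m)) ⟩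
    q ^ (t * m) * Q ^ (t * m) * (C ^ (k * 2) * C ^ (n * k * 2))     ≤⟨ *-monoˡ-≤ _ qQ≤ ⟩
    C ^ (3 * (t * n)) * (C ^ (k * 2) * C ^ (n * k * 2))             ∎
    where
    swap : ∀ a b c → a * b * c ≡ a * c * b
    swap = solve-∀
  collectC : C ^ m * (C ^ (3 * (t * n)) * (C ^ (k * 2) * C ^ (n * k * 2))) ≡ C ^ (m + (3 * (t * n) + (k * 2 + n * k * 2)))
  collectC = sym (trans (^-distribˡ-+-* C m _) (cong (C ^ m *_)
    (trans (^-distribˡ-+-* C (3 * (t * n)) _) (cong (C ^ (3 * (t * n)) *_) (^-distribˡ-+-* C (k * 2) (n * k * 2))))))
  exponent : m + (3 * (t * n) + (k * 2 + n * k * 2)) ≤ n * (ℓ + 10) + ℓ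
  exponent = ≤-trans (m≤m+n _ (n * 8 + n * ε + 3 * t + ε)) (≤-reflexive (expand n t k ε))
    where
    expand : ∀ n t k ε → n * 2 + (3 * (t * n) + (k * 2 + n * k * 2)) + (n * 8 + n * ε + 3 * t + ε)
      ≡ n * (t + (k + (ε + (k + t + t))) + 10) + (t + (k + (ε + (k + t + t))))
    expand = solve-∀

bounded-long : ∀ q t k ε .{{_ : NonZero q}} → ε ≤ 1 → let ℓ = t + (k + (ε + (k + t + t))) in
  Bounded q ℓ t (numTailHeavy q ℓ t)
bounded-long q t k ε ε≤1 with maximiser t (weightedPairs q t k ε)
... | σ , max = go (ℓ <ᵇ ∣ σ ∣ * ∣ σ ∣) refl
  where
  ℓ = t + (k + (ε + (k + t + t)))
  P = compatiblePairs q k (k + t) (at σ)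
  N≤ : numTailHeavy q ℓ t ≤ q ^ t * (q ^ ε * (weightedPairs q t k ε σ * suc q ^ t))
  N≤ = numTailHeavy≤ q t k ε (weightedPairs q t k ε σ) max
  go : ∀ b → (ℓ <ᵇ ∣ σ ∣ * ∣ σ ∣) ≡ b → Bounded q ℓ t (numTailHeavy q ℓ t)
  -- If the maximiser has n² ≤ ℓ, its weight is 0; then every weight is 0 and no word is tail-heavy.
  go false small = bounded-from-square q ℓ t _ (≤-trans (≤-reflexive (cong (_^ 2) N≡0)) z≤n)
    where
    N≡0 : numTailHeavy q ℓ t ≡ 0
    N≡0 = n≤0⇒n≡0 (≤-trans N≤ (≤-reflexive (trans (cong (λ b → q ^ t * (q ^ ε * (bit b * P * suc q ^ t))) small)
            (trans (cong (q ^ t *_) (*-zeroʳ (q ^ ε))) (*-zeroʳ (q ^ t))))))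
  go true large = n , n≢0 , <⇒≤ ℓ<n² ,
    combine-bounds q t k ε n _ P ε≤1
      (≤-trans N≤ (≤-reflexive (cong (λ p → q ^ t * (q ^ ε * (p * suc q ^ t))) (trans (cong (λ b → bit b * P) large) (+-identityʳ P)))))
      (compatiblePairs-bound q k t n {{n≢0}} (at σ) (λ r t≤r → sym (size≡trues σ r t≤r)))
    where
    n = ∣ σ ∣
    ℓ<n² : ℓ < n * n
    ℓ<n² = <ᵇ⇒< ℓ (n * n) (subst T (sym large) tt)
    n≢0 : NonZero n
    n≢0 = m*n≢0⇒m≢0 n {{>-nonZero (≤-<-trans z≤n ℓ<n²)}}

-- The threshold 3t fits both cases. The blocks need ℓ = 3t + 2k + ε. Below it, q^(ℓ - t) ≤ c_q^(3(ℓ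
-- - t)/2) for t ≤ ℓ, and 3(ℓ - t)/2 ≤ ℓ is equivalent to ℓ ≤ 3t.
numTailHeavy-bounded : ∀ q ℓ t .{{_ : NonZero q}} → Bounded q ℓ t (numTailHeavy q ℓ t)
numTailHeavy-bounded q ℓ t with ℓ <? 3 * t
... | yes ℓ<3t =
  let n , n≢0 , ℓ≤n² , q^ℓ≤ = bounded-short q ℓ t ℓ<3t
  in n , n≢0 , ℓ≤n² , ≤-trans (^-monoˡ-≤ (n * 2) (numTailHeavy≤q^ℓ q ℓ t)) q^ℓ≤
... | no ℓ≮3t = subst (λ ℓ → Bounded q ℓ t (numTailHeavy q ℓ t)) (sym ℓ≡) (bounded-long q t (r / 2) (r % 2) (s≤s⁻¹ (m%n<n r 2)))
  where
  r = ℓ ∸ 3 * t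
  ℓ≡ : ℓ ≡ t + (r / 2 + (r % 2 + (r / 2 + t + t)))
  ℓ≡ = trans (sym (m+[n∸m]≡n (≮⇒≥ ℓ≮3t))) (trans (cong (3 * t +_) (m≡m%n+[m/n]*n r 2)) (regroup t (r / 2) (r % 2)))
    where
    regroup : ∀ t k ε → 3 * t + (ε + k * 2) ≡ t + (k + (ε + (k + t + t)))
    regroup = solve-∀

-- From natural numbers to rationals.

toℚᵘ-ℕ→ℚ : ∀ n → ℚ.toℚᵘ (ℕ→ℚ n) ℚᵘ.≃ mkℚᵘ (ℤ.+ n) 0
toℚᵘ-ℕ→ℚ n = ℚₚ.toℚᵘ-fromℚᵘ (mkℚᵘ (ℤ.+ n) 0)

ℕ→ℚ-homo-+ : ∀ m n → ℕ→ℚ (m + n) ≡ ℕ→ℚ m ℚ.+ ℕ→ℚ n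
ℕ→ℚ-homo-+ m n = ℚₚ.toℚᵘ-injective (begin
  ℚ.toℚᵘ (ℕ→ℚ (m + n))                          ≈⟨ toℚᵘ-ℕ→ℚ (m + n) ⟩
  mkℚᵘ (ℤ.+ (m + n)) 0                            ≈⟨ *≡* (cong (ℤ._* ℤ.+ 1) (cong ℤ.+_ (cong₂ _+_ (sym (*-identityʳ m)) (sym (*-identityʳ n))))) ⟩
  mkℚᵘ (ℤ.+ (m * 1 + n * 1)) 0                    ≈⟨ *≡* (cong (ℤ._* ℤ.+ 1) (cong₂ ℤ._+_ (ℤₚ.pos-* m 1) (ℤₚ.pos-* n 1))) ⟩
  mkℚᵘ (ℤ.+ m) 0 ℚᵘ.+ mkℚᵘ (ℤ.+ n) 0                ≈⟨ ℚᵘₚ.+-cong (toℚᵘ-ℕ→ℚ m) (toℚᵘ-ℕ→ℚ n) ⟨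
  ℚ.toℚᵘ (ℕ→ℚ m) ℚᵘ.+ ℚ.toℚᵘ (ℕ→ℚ n)            ≈⟨ ℚₚ.toℚᵘ-homo-+ (ℕ→ℚ m) (ℕ→ℚ n) ⟨
  ℚ.toℚᵘ (ℕ→ℚ m ℚ.+ ℕ→ℚ n)                      ∎)
  where open ℚᵘₚ.≃-Reasoning

ℕ→ℚ-homo-* : ∀ m n → ℕ→ℚ (m * n) ≡ ℕ→ℚ m ℚ.* ℕ→ℚ n
ℕ→ℚ-homo-* m n = ℚₚ.toℚᵘ-injective (begin
  ℚ.toℚᵘ (ℕ→ℚ (m * n))                          ≈⟨ toℚᵘ-ℕ→ℚ (m * n) ⟩
  mkℚᵘ (ℤ.+ (m * n)) 0                            ≈⟨ *≡* (cong (ℤ._* ℤ.+ 1) (ℤₚ.pos-* m n)) ⟩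
  mkℚᵘ (ℤ.+ m) 0 ℚᵘ.* mkℚᵘ (ℤ.+ n) 0                ≈⟨ ℚᵘₚ.*-cong (toℚᵘ-ℕ→ℚ m) (toℚᵘ-ℕ→ℚ n) ⟨
  ℚ.toℚᵘ (ℕ→ℚ m) ℚᵘ.* ℚ.toℚᵘ (ℕ→ℚ n)            ≈⟨ ℚₚ.toℚᵘ-homo-* (ℕ→ℚ m) (ℕ→ℚ n) ⟨
  ℚ.toℚᵘ (ℕ→ℚ m ℚ.* ℕ→ℚ n)                      ∎)
  where open ℚᵘₚ.≃-Reasoning

ℕ→ℚ-homo-^ : ∀ m n → ℕ→ℚ (m ^ n) ≡ ℕ→ℚ m ^ℚ n
ℕ→ℚ-homo-^ m zero    = refl
ℕ→ℚ-homo-^ m (suc n) = trans (ℕ→ℚ-homo-* m (m ^ n)) (cong (ℕ→ℚ m ℚ.*_) (ℕ→ℚ-homo-^ m n))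

ℕ→ℚ-mono-≤ : ∀ {m n} → m ≤ n → ℕ→ℚ m ℚ.≤ ℕ→ℚ n
ℕ→ℚ-mono-≤ {m} {n} m≤n = ℚₚ.toℚᵘ-cancel-≤
  (ℚᵘₚ.≤-respʳ-≃ (ℚᵘₚ.≃-sym (toℚᵘ-ℕ→ℚ n)) (ℚᵘₚ.≤-respˡ-≃ (ℚᵘₚ.≃-sym (toℚᵘ-ℕ→ℚ m))
    (*≤* (ℤₚ.*-monoʳ-≤-nonNeg (ℤ.+ 1) (ℤ.+≤+ m≤n)))))

ℕ→ℚ-cancel-≤ : ∀ {m n} → ℕ→ℚ m ℚ.≤ ℕ→ℚ n → m ≤ n
ℕ→ℚ-cancel-≤ {m} {n} m≤n
  with ℚᵘₚ.≤-respʳ-≃ (toℚᵘ-ℕ→ℚ n) (ℚᵘₚ.≤-respˡ-≃ (toℚᵘ-ℕ→ℚ m) (ℚₚ.toℚᵘ-mono-≤ m≤n))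
... | *≤* m1≤n1 = ℤₚ.drop‿+≤+ (ℤₚ.*-cancelʳ-≤-pos (ℤ.+ m) (ℤ.+ n) (ℤ.+ 1) m1≤n1)

0≤ℕ→ℚ : ∀ n → 0ℚ ℚ.≤ ℕ→ℚ n
0≤ℕ→ℚ n = ℕ→ℚ-mono-≤ {0} {n} z≤n

p*↧p≡num : ∀ p → 0ℚ ℚ.≤ p → p ℚ.* ℕ→ℚ (↧ₙ p) ≡ ℕ→ℚ (num p)
p*↧p≡num p@(mkℚ n d-1 _) 0≤p = ℚₚ.toℚᵘ-injective (begin
  ℚ.toℚᵘ (p ℚ.* ℕ→ℚ (↧ₙ p))                      ≈⟨ ℚₚ.toℚᵘ-homo-* p (ℕ→ℚ (↧ₙ p)) ⟩
  ℚ.toℚᵘ p ℚᵘ.* ℚ.toℚᵘ (ℕ→ℚ (↧ₙ p))              ≈⟨ ℚᵘₚ.*-cong (ℚᵘₚ.≃-refl {ℚ.toℚᵘ p}) (toℚᵘ-ℕ→ℚ (↧ₙ p)) ⟩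
  mkℚᵘ n d-1 ℚᵘ.* mkℚᵘ (ℤ.+ suc d-1) 0             ≈⟨ *≡* cross ⟩
  mkℚᵘ (ℤ.+ ℤ.∣ n ∣) 0                              ≈⟨ toℚᵘ-ℕ→ℚ (num p) ⟨
  ℚ.toℚᵘ (ℕ→ℚ (num p))                           ∎)
  where
  open ℚᵘₚ.≃-Reasoning
  n≡ : ℤ.+ ℤ.∣ n ∣ ≡ n
  n≡ = ℤₚ.0≤i⇒+∣i∣≡i (ℤₚ.nonNegative⁻¹ n {{ℚ.nonNegative 0≤p}})
  cross : n ℤ.* ℤ.+ suc d-1 ℤ.* ℤ.+ 1 ≡ ℤ.+ ℤ.∣ n ∣ ℤ.* ℤ.+ (suc d-1 * 1)
  cross = trans (ℤₚ.*-identityʳ _) (cong₂ ℤ._*_ (sym n≡) (cong ℤ.+_ (sym (*-identityʳ (suc d-1)))))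

*-mono-≤-0≤ : ∀ {a b u v} → 0ℚ ℚ.≤ a → 0ℚ ℚ.≤ v → a ℚ.≤ b → u ℚ.≤ v → a ℚ.* u ℚ.≤ b ℚ.* v
*-mono-≤-0≤ {a} {b} {u} {v} 0≤a 0≤v a≤b u≤v =
  ℚₚ.≤-trans (ℚₚ.*-monoˡ-≤-nonNeg a {{ℚ.nonNegative 0≤a}} u≤v) (ℚₚ.*-monoʳ-≤-nonNeg v {{ℚ.nonNegative 0≤v}} a≤b)

0≤-* : ∀ {a b} → 0ℚ ℚ.≤ a → 0ℚ ℚ.≤ b → 0ℚ ℚ.≤ a ℚ.* b
0≤-* {a} {b} 0≤a 0≤b =
  subst (ℚ._≤ a ℚ.* b) (ℚₚ.*-zeroʳ a) (ℚₚ.*-monoˡ-≤-nonNeg a {{ℚ.nonNegative 0≤a}} 0≤b)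

0≤-^ : ∀ {a} n → 0ℚ ℚ.≤ a → 0ℚ ℚ.≤ a ^ℚ n
0≤-^ zero    0≤a = 0≤ℕ→ℚ 1
0≤-^ (suc n) 0≤a = 0≤-* 0≤a (0≤-^ n 0≤a)

^ℚ-mono-≤ : ∀ {a b} n → 0ℚ ℚ.≤ a → a ℚ.≤ b → a ^ℚ n ℚ.≤ b ^ℚ n
^ℚ-mono-≤ zero    0≤a a≤b = ℚₚ.≤-refl
^ℚ-mono-≤ (suc n) 0≤a a≤b = *-mono-≤-0≤ 0≤a (0≤-^ n (ℚₚ.≤-trans 0≤a a≤b)) a≤b (^ℚ-mono-≤ n 0≤a a≤b)

^ℚ-mono-< : ∀ {a b} n → 0ℚ ℚ.≤ a → a ℚ.< b → a ^ℚ suc n ℚ.< b ^ℚ suc n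
^ℚ-mono-< {a} {b} zero    0≤a a<b = subst₂ ℚ._<_ (sym (ℚₚ.*-identityʳ a)) (sym (ℚₚ.*-identityʳ b)) a<b
^ℚ-mono-< {a} {b} (suc n) 0≤a a<b with ^ℚ-mono-< n 0≤a a<b
... | aⁿ<bⁿ = ℚₚ.≤-<-trans
  (ℚₚ.*-monoˡ-≤-nonNeg a {{ℚ.nonNegative 0≤a}} (ℚₚ.<⇒≤ aⁿ<bⁿ))
  (ℚₚ.*-monoˡ-<-pos (b ^ℚ suc n) {{ℚ.positive (ℚₚ.≤-<-trans (0≤-^ (suc n) 0≤a) aⁿ<bⁿ)}} a<b)

^ℚ-cancel-≤ : ∀ {a b} n .{{_ : NonZero n}} → 0ℚ ℚ.≤ b → a ^ℚ n ℚ.≤ b ^ℚ n → a ℚ.≤ b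
^ℚ-cancel-≤ {a} {b} (suc n) 0≤b aⁿ≤bⁿ with a ℚ.≤? b
... | yes a≤b = a≤b
... | no  a≰b = contradiction (ℚₚ.<-≤-trans (^ℚ-mono-< n 0≤b (ℚₚ.≰⇒> a≰b)) aⁿ≤bⁿ) (ℚₚ.<-irrefl refl)

-- Passage to the real exponent.

-- Multiplying the two hypotheses gives ℓ² ≤ (n y)². This is ℓ / n ≤ √ℓ, read on an upper
-- approximation y of √ℓ.
√-upper : ∀ {ℓ} n {y} → ℓ ≤ n * n → 0ℚ ℚ.≤ y → ℕ→ℚ ℓ ℚ.≤ y ^ℚ 2 → ℕ→ℚ ℓ ℚ.≤ ℕ→ℚ n ℚ.* y
√-upper {ℓ} n {y} ℓ≤n² 0≤y ℓ≤y² = ^ℚ-cancel-≤ 2 (0≤-* (0≤ℕ→ℚ n) 0≤y) (begin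
  ℕ→ℚ ℓ ^ℚ 2                   ≡⟨ cong (ℕ→ℚ ℓ ℚ.*_) (ℚₚ.*-identityʳ (ℕ→ℚ ℓ)) ⟩
  ℕ→ℚ ℓ ℚ.* ℕ→ℚ ℓ              ≤⟨ *-mono-≤-0≤ (0≤ℕ→ℚ ℓ) (0≤-^ 2 0≤y) (ℕ→ℚ-mono-≤ ℓ≤n^2) ℓ≤y² ⟩
  ℕ→ℚ (n ^ 2) ℚ.* y ^ℚ 2       ≡⟨ cong (ℚ._* y ^ℚ 2) (ℕ→ℚ-homo-^ n 2) ⟩
  ℕ→ℚ n ^ℚ 2 ℚ.* y ^ℚ 2        ≡⟨ ^ℚ-distrib-* (ℕ→ℚ n) y 2 ⟨
  (ℕ→ℚ n ℚ.* y) ^ℚ 2           ∎)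
  where
  open ℚₚ.≤-Reasoning
  ℓ≤n^2 : ℓ ≤ n ^ 2
  ℓ≤n^2 = ≤-trans ℓ≤n² (≤-reflexive (cong (n *_) (sym (*-identityʳ n))))

-- Divided by n and the denominator of p, this is ℓ + 10 + ℓ/n ≤ p, where ℓ/n is at most the summand
-- of p that bounds √ℓ.
exponent-upper : ∀ {ℓ} n {p} → ℓ ≤ n * n → Upper (ℕ→ℝ ℓ +ᴿ √ ℓ +ᴿ ℕ→ℝ 10) p →
  (n * (ℓ + 10) + ℓ) * ↧ₙ p ≤ n * num p
exponent-upper {ℓ} n {p} ℓ≤n² Up@(_ , z , (x , y , ℓ≤x , (0≤y , ℓ≤y²) , refl) , 10≤z , p≡) = ℕ→ℚ-cancel-≤ (begin
  ℕ→ℚ ((n * (ℓ + 10) + ℓ) * ↧ₙ p)                                ≡⟨ ℕ→ℚ-homo-* (n * (ℓ + 10) + ℓ) (↧ₙ p) ⟩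
  ℕ→ℚ (n * (ℓ + 10) + ℓ) ℚ.* ℕ→ℚ (↧ₙ p)                          ≤⟨ ℚₚ.*-monoʳ-≤-nonNeg (ℕ→ℚ (↧ₙ p)) {{ℚ.nonNegative (0≤ℕ→ℚ (↧ₙ p))}} E≤np ⟩
  ℕ→ℚ n ℚ.* p ℚ.* ℕ→ℚ (↧ₙ p)                                     ≡⟨ ℚₚ.*-assoc (ℕ→ℚ n) p (ℕ→ℚ (↧ₙ p)) ⟩
  ℕ→ℚ n ℚ.* (p ℚ.* ℕ→ℚ (↧ₙ p))                                   ≡⟨ cong (ℕ→ℚ n ℚ.*_) (p*↧p≡num p (nonneg (ℕ→ℝ ℓ +ᴿ √ ℓ +ᴿ ℕ→ℝ 10) Up)) ⟩
  ℕ→ℚ n ℚ.* ℕ→ℚ (num p)                                          ≡⟨ ℕ→ℚ-homo-* n (num p) ⟨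
  ℕ→ℚ (n * num p)                                                ∎)
  where
  open ℚₚ.≤-Reasoning
  E≤np : ℕ→ℚ (n * (ℓ + 10) + ℓ) ℚ.≤ ℕ→ℚ n ℚ.* p
  E≤np = begin
    ℕ→ℚ (n * (ℓ + 10) + ℓ)                                ≡⟨ ℕ→ℚ-homo-+ (n * (ℓ + 10)) ℓ ⟩
    ℕ→ℚ (n * (ℓ + 10)) ℚ.+ ℕ→ℚ ℓ                          ≡⟨ cong (ℚ._+ ℕ→ℚ ℓ) (trans (ℕ→ℚ-homo-* n (ℓ + 10)) (cong (ℕ→ℚ n ℚ.*_) (ℕ→ℚ-homo-+ ℓ 10))) ⟩
    ℕ→ℚ n ℚ.* (ℕ→ℚ ℓ ℚ.+ ℕ→ℚ 10) ℚ.+ ℕ→ℚ ℓ                ≤⟨ ℚₚ.+-mono-≤ (ℚₚ.*-monoˡ-≤-nonNeg (ℕ→ℚ n) {{ℚ.nonNegative (0≤ℕ→ℚ n)}} (ℚₚ.+-mono-≤ ℓ≤x 10≤z)) (√-upper n ℓ≤n² 0≤y ℓ≤y²) ⟩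
    ℕ→ℚ n ℚ.* (x ℚ.+ z) ℚ.+ ℕ→ℚ n ℚ.* y                   ≡⟨ ℚₚ.*-distribˡ-+ (ℕ→ℚ n) (x ℚ.+ z) y ⟨
    ℕ→ℚ n ℚ.* (x ℚ.+ z ℚ.+ y)                             ≡⟨ cong (ℕ→ℚ n ℚ.*_) (trans (ℚₚ.+-assoc x z y) (trans (cong (x ℚ.+_) (ℚₚ.+-comm z y)) (trans (sym (ℚₚ.+-assoc x y z)) (sym p≡)))) ⟩
    ℕ→ℚ n ℚ.* p                                           ∎

-- With p = e/d, the common exponent 2nd clears every root: the square root in c_q, the n-th root in
-- `Bounded` and the d-th root in the real power. The chain for C is C^(ne) ≤ s^(2ne) ≤ b^(2nd).
bounded⇒≤ : ∀ {q ℓ t N b} .{{_ : NonZero q}} → Bounded q ℓ t N →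
  Upper (c q ^ᴿ (ℕ→ℝ ℓ +ᴿ √ ℓ +ᴿ ℕ→ℝ 10)) b → ℕ→ℚ N ℚ.≤ ℕ→ℚ (q ^ t) ℚ.* b
bounded⇒≤ {q} {ℓ} {t} {N} {b} (n@(suc _) , _ , ℓ≤n² , N²ⁿ≤) (0≤b , s , p , (0≤s , C≤s²) , Up , sᵖ≤b) =
  ^ℚ-cancel-≤ (n * 2 * d) {{m*n≢0 (n * 2) d}} (0≤-* (0≤ℕ→ℚ (q ^ t)) 0≤b) (begin
  ℕ→ℚ N ^ℚ (n * 2 * d)                                   ≡⟨ ℕ→ℚ-homo-^ N (n * 2 * d) ⟨
  ℕ→ℚ (N ^ (n * 2 * d))                                  ≤⟨ ℕ→ℚ-mono-≤ N≤ ⟩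
  ℕ→ℚ ((q ^ t) ^ (n * 2 * d) * C ^ (n * e))              ≡⟨ ℕ→ℚ-homo-* ((q ^ t) ^ (n * 2 * d)) (C ^ (n * e)) ⟩
  ℕ→ℚ ((q ^ t) ^ (n * 2 * d)) ℚ.* ℕ→ℚ (C ^ (n * e))      ≡⟨ cong₂ ℚ._*_ (ℕ→ℚ-homo-^ (q ^ t) (n * 2 * d)) (ℕ→ℚ-homo-^ C (n * e)) ⟩
  ℕ→ℚ (q ^ t) ^ℚ (n * 2 * d) ℚ.* ℕ→ℚ C ^ℚ (n * e)        ≤⟨ ℚₚ.*-monoˡ-≤-nonNeg (ℕ→ℚ (q ^ t) ^ℚ (n * 2 * d)) {{ℚ.nonNegative (0≤-^ (n * 2 * d) (0≤ℕ→ℚ (q ^ t)))}} C≤b ⟩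
  ℕ→ℚ (q ^ t) ^ℚ (n * 2 * d) ℚ.* b ^ℚ (n * 2 * d)        ≡⟨ ^ℚ-distrib-* (ℕ→ℚ (q ^ t)) b (n * 2 * d) ⟨
  (ℕ→ℚ (q ^ t) ℚ.* b) ^ℚ (n * 2 * d)                     ∎)
  where
  open ℚₚ.≤-Reasoning
  C = c² q
  d = ↧ₙ p
  e = num p
  E = n * (ℓ + 10) + ℓ
  N≤ : N ^ (n * 2 * d) ≤ (q ^ t) ^ (n * 2 * d) * C ^ (n * e)
  N≤ = ≤-trans (≤-reflexive (sym (^-*-assoc N (n * 2) d)))
    (≤-trans (^-monoˡ-≤ d N²ⁿ≤)
    (≤-trans (≤-reflexive (trans (^-distrib-* (q ^ (t * (n * 2))) (C ^ E) d) (cong₂ _*_ qᵗ≡ (^-*-assoc C E d))))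
             (*-monoʳ-≤ ((q ^ t) ^ (n * 2 * d)) (^-monoʳ-≤ C {{c²-nonZero q}} (exponent-upper n ℓ≤n² Up)))))
    where
    qᵗ≡ : (q ^ (t * (n * 2))) ^ d ≡ (q ^ t) ^ (n * 2 * d)
    qᵗ≡ = trans (cong (_^ d) (sym (^-*-assoc q t (n * 2)))) (^-*-assoc (q ^ t) (n * 2) d)
  C≤b : ℕ→ℚ C ^ℚ (n * e) ℚ.≤ b ^ℚ (n * 2 * d)
  C≤b = begin
    ℕ→ℚ C ^ℚ (n * e)         ≤⟨ ^ℚ-mono-≤ (n * e) (0≤ℕ→ℚ C) C≤s² ⟩
    (s ^ℚ 2) ^ℚ (n * e)      ≡⟨ trans (^ℚ-assocʳ s 2 (n * e)) (trans (cong (s ^ℚ_) (swap n e)) (sym (^ℚ-assocʳ s e (n * 2)))) ⟩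
    (s ^ℚ e) ^ℚ (n * 2)      ≤⟨ ^ℚ-mono-≤ (n * 2) (0≤-^ e 0≤s) sᵖ≤b ⟩
    (b ^ℚ d) ^ℚ (n * 2)      ≡⟨ trans (^ℚ-assocʳ b d (n * 2)) (cong (b ^ℚ_) (*-comm d (n * 2))) ⟩
    b ^ℚ (n * 2 * d)         ∎
    where
    swap : ∀ n e → 2 * (n * e) ≡ e * (n * 2)
    swap = solve-∀

theorem3p7 : (q ℓ t : ℕ) → .{{_ : NonZero q}} → .{{_ : NonZero ℓ}} → .{{_ : NonZero t}} →
    ℕ→ℝ (numTailHeavy q ℓ t) ≤ᴿ ℕ→ℝ (t * q ^ t) *ᴿ c q ^ᴿ (ℕ→ℝ ℓ +ᴿ √ ℓ +ᴿ ℕ→ℝ 10)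
theorem3p7 q ℓ t {_} {r} (a , b , tqᵗ≤a , Ub@(0≤b , _) , refl) ab<r =
  ℕ→ℚ (numTailHeavy q ℓ t) , ℚₚ.≤-refl , ℚₚ.≤-<-trans (begin
    ℕ→ℚ (numTailHeavy q ℓ t)      ≤⟨ bounded⇒≤ {q} {ℓ} {t} (numTailHeavy-bounded q ℓ t) Ub ⟩
    ℕ→ℚ (q ^ t) ℚ.* b             ≤⟨ ℚₚ.*-monoʳ-≤-nonNeg b {{ℚ.nonNegative 0≤b}} (ℚₚ.≤-trans (ℕ→ℚ-mono-≤ (m≤n*m (q ^ t) t)) tqᵗ≤a) ⟩
    a ℚ.* b                       ∎) ab<r
  where open ℚₚ.≤-Reasoning
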